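{- In the advice-with-request model, and likewise in the advice-on-tape model, there exists an online edge-coloring algorithm which, on every input graph $G$ with $m$ edges (in any arrival order), produces an optimal edge coloring (using $\chi'(G)$ colors) and uses $O(m\log d)$ bits of advice in total, where $d$ is the degeneracy of $G$ (no bound on $d$ is known to the algorithm in advance).
   Context: All graphs are simple. An edge coloring assigns colors to edges so that adjacent edges get different colors; $\chi'(G)$ is the minimum number of colors needed. A graph is $d$-degenerate if its vertices can be ordered $v_1,\dots,v_n$ so that each $v_i$ has at most $d$ neighbors among $v_1,\dots,v_{i-1}$; the degeneracy of $G$ is the least such $d$. Online edge coloring: edges arrive one at a time, specified by their endpoints; each must be irrevocably colored before the next arrives, keeping the coloring proper. Advice-with-request model: with each edge the algorithm receives a fixed number $b$ of advice bits from an all-knowing oracle, and may use only the edges and advice seen so far (total advice $bm$). Advice-on-tape model: the algorithm may at any time read bits from an infinite advice tape prepared by an all-knowing oracle; each coloring decision may depend only on edges revealed so far and advice read so far; the amount of advice is the number of bits read. -}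

module Defs where

open import Data.Nat using (ℕ; zero; suc; _+_; _*_; _≤_; _<_)
open import Data.Nat.Properties using (_≟_)
open import Data.Nat.Logarithm using (⌊log₂_⌋)
open import Data.Bool using (Bool)
open import Data.Maybe using (Maybe; just; nothing)
open import Data.Product using (Σ; _×_; _,_; proj₁; proj₂)
open import Data.Sum using (_⊎_)
open import Data.Fin using (Fin; toℕ)
open import Data.List using (List; []; _∷_; _++_; [_]; length; lookup; take; filter; applyUpTo; tabulate)
open import Data.List.Relation.Unary.All using (All)
open import Data.List.Relation.Unary.Any using (Any; any?)
open import Data.List.Membership.Propositional using (_∈_)
open import Data.List.Relation.Unary.Unique.Propositional using (Unique)
open import Data.Vec using (Vec)
open import Relation.Nullary using (¬_; Dec)
open import Relation.Nullary.Decidable using (_×-dec_; _⊎-dec_)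
open import Relation.Binary.PropositionalEquality using (_≡_; _≢_)

-- Graphs given as edge sequences (arrival order); vertices are naturals.

Edge : Set
Edge = ℕ × ℕ

SameEdge : Edge → Edge → Set
SameEdge (a , b) (c , d) = (a ≡ c × b ≡ d) ⊎ (a ≡ d × b ≡ c)

sameEdge? : (e f : Edge) → Dec (SameEdge e f)
sameEdge? (a , b) (c , d) = ((a ≟ c) ×-dec (b ≟ d)) ⊎-dec ((a ≟ d) ×-dec (b ≟ c))

Adjacent : Edge → Edge → Set
Adjacent (a , b) (c , d) = (a ≡ c ⊎ a ≡ d) ⊎ (b ≡ c ⊎ b ≡ d)

SimpleGraph : List Edge → Set
SimpleGraph σ =
  All (λ e → proj₁ e ≢ proj₂ e) σ ×
  ((i j : Fin (length σ)) → i ≢ j → ¬ SameEdge (lookup σ i) (lookup σ j))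

HasEdge : List Edge → ℕ → ℕ → Set
HasEdge σ u v = Any (λ e → SameEdge e (u , v)) σ

hasEdge? : (σ : List Edge) (v u : ℕ) → Dec (HasEdge σ u v)
hasEdge? σ v u = any? (λ e → sameEdge? e (u , v)) σ

nth : List ℕ → ℕ → ℕ
nth []       _       = 0
nth (x ∷ xs) zero    = x
nth (x ∷ xs) (suc k) = nth xs k

ProperColoring : List Edge → List ℕ → Set
ProperColoring σ cs =
  length cs ≡ length σ ×
  ((i j : Fin (length σ)) → i ≢ j → Adjacent (lookup σ i) (lookup σ j) →
     nth cs (toℕ i) ≢ nth cs (toℕ j))

Colorable : List Edge → ℕ → Set
Colorable σ k = Σ (List ℕ) λ cs → ProperColoring σ cs × All (_< k) cs

IsChromaticIndex : List Edge → ℕ → Set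
IsChromaticIndex σ k = Colorable σ k × ((k' : ℕ) → Colorable σ k' → k ≤ k')

UsesAtMost : List ℕ → ℕ → Set
UsesAtMost cs k = Σ (List ℕ) λ L → length L ≤ k × All (_∈ L) cs

OptimalColoring : List Edge → List ℕ → Set
OptimalColoring σ cs =
  ProperColoring σ cs × ((k : ℕ) → IsChromaticIndex σ k → UsesAtMost cs k)

-- Degeneracy. The vertex set is the set of endpoints of edges.

Degenerate : List Edge → ℕ → Set
Degenerate σ d =
  Σ (List ℕ) λ ord →
    Unique ord ×
    All (λ e → proj₁ e ∈ ord × proj₂ e ∈ ord) σ ×
    ((i : Fin (length ord)) →
       length (filter (hasEdge? σ (lookup ord i)) (take (toℕ i) ord)) ≤ d)

IsDegeneracy : List Edge → ℕ → Set
IsDegeneracy σ d = Degenerate σ d × ((d' : ℕ) → Degenerate σ d' → d ≤ d')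

-- advice bound  O(m log d), read as  C · m · (1 + ⌊log₂ d⌋)
AdviceBound : ℕ → List Edge → ℕ → Set
AdviceBound C σ bits =
  (d : ℕ) → IsDegeneracy σ d → bits ≤ C * length σ * (1 + ⌊log₂ d ⌋)

-- Advice-with-request model.  The oracle fixes, for the given input, a
-- number b and sends a b-bit string with each edge.  The color of the k-th
-- edge is computed from the first k edges and the first k advice strings.

AlgR : Set
AlgR = (b : ℕ) → List Edge → List (Vec Bool b) → ℕ

runR : AlgR → (b : ℕ) → List Edge → List (Vec Bool b) → List ℕ
runR alg b σ adv =
  applyUpTo (λ k → alg b (take (suc k) σ) (take (suc k) adv)) (length σ)

-- Advice-on-tape model.  Given the edges revealed so far (last one is the
-- current edge) and the tape bits read so far, the algorithm either outputs
-- a color for the current edge (just c) or reads the next tape bit (nothing).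

AlgT : Set
AlgT = List Edge → List Bool → Maybe ℕ

prefix : (ℕ → Bool) → ℕ → List Bool
prefix tape r = tabulate {n = r} (λ i → tape (toℕ i))

-- Serve alg tape es r r' c : serving the last edge of es, having read r bits
-- before, the algorithm ends having read r' bits and outputs color c.
data Serve (alg : AlgT) (tape : ℕ → Bool) (es : List Edge) : ℕ → ℕ → ℕ → Set where
  output : ∀ {r c} → alg es (prefix tape r) ≡ just c → Serve alg tape es r r c
  read   : ∀ {r r' c} → alg es (prefix tape r) ≡ nothing →
           Serve alg tape es (suc r) r' c → Serve alg tape es r r' c

data RunT (alg : AlgT) (tape : ℕ → Bool) : List Edge → List ℕ → ℕ → Set where
  start : RunT alg tape [] [] 0
  step  : ∀ {es cs r r' e c} → RunT alg tape es cs r →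
          Serve alg tape (es ++ [ e ]) r r' c →
          RunT alg tape (es ++ [ e ]) (cs ++ [ c ]) r'

AdviceWithRequestClaim : Set
AdviceWithRequestClaim =
  Σ AlgR λ alg → Σ ℕ λ C →
    (σ : List Edge) → SimpleGraph σ →
    Σ ℕ λ b → Σ (List (Vec Bool b)) λ adv →
      length adv ≡ length σ ×
      OptimalColoring σ (runR alg b σ adv) ×
      AdviceBound C σ (b * length σ)

AdviceOnTapeClaim : Set
AdviceOnTapeClaim =
  Σ AlgT λ alg → Σ ℕ λ C →
    (σ : List Edge) → SimpleGraph σ →
    Σ (ℕ → Bool) λ tape → Σ (List ℕ) λ cs → Σ ℕ λ r →
      RunT alg tape σ cs r ×
      OptimalColoring σ cs ×
      AdviceBound C σ r

{-# OPTIONS --safe #-}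
module Submission where

-- Orient every edge from the earlier to the later endpoint of a d-degenerate
-- order, so that in-degrees are at most d.  One advice bit per edge reveals the
-- orientation, hence the algorithm knows the number i of earlier out-arcs of the
-- tail.  It suffices that some optimal colouring gives the arc a colour within
-- O(d) of i: the difference then takes O(log d) bits.
--
-- Let χ be the chromatic index and B ≥ 2d a power of two with B = O(d).  If χ < B,
-- every colour is close to i.  Otherwise cut the χ colours into intervals
-- ("palettes") of B to 2B colours.  Going through the vertices in the degenerate
-- order, the at most d in-arcs of u already have a palette, and the out-arcs of u
-- fill up the remaining room of palettes 0, 1, 2, … in order of arrival, so the
-- palette of the i-th out-arc lies near position i.  In each palette the maximum
-- degree is at most the number of its colours, which is at least 2d, and a
-- d-degenerate graph with at least 2d colours is of class one (Vizing).
--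
-- The oracle sends the shortest advice that works, found by finite search; on the
-- tape its length b is announced in unary.

open import Defs

open import Data.Bool using (Bool; true; false; not; if_then_else_)
open import Data.Empty using (⊥; ⊥-elim)
open import Data.Fin using (Fin; zero; suc; toℕ; fromℕ<)
import Data.Fin.Properties as Fin
open import Data.Fin.Properties using (toℕ<n; toℕ-injective; toℕ-fromℕ<)
open import Data.List
  using (List; []; _∷_; [_]; _++_; length; map; filter; upTo; applyUpTo; lookup; take; drop;
         replicate; concatMap; allFin; deduplicate)
open import Data.List.Membership.Propositional using (_∈_; _∉_; find; lose)
open import Data.List.Membership.Propositional.Properties
open import Data.List.Properties
  using (length-++; length-map; length-filter; length-take; length-replicate; length-upTo;
         length-applyUpTo; filter-++; filter-accept; ++-assoc; take-suc; take-all; applyUpTo-∷ʳ)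
open import Data.List.Relation.Binary.Permutation.Propositional using (↭-sym; ↭⇒↭ₛ)
open import Data.List.Relation.Binary.Permutation.Propositional.Properties
  using (∈-resp-↭; ↭-length; filter-↭)
import Data.List.Relation.Binary.Permutation.Setoid.Properties as Permutation
open import Data.List.Relation.Unary.All as All using (All; []; _∷_; all?)
  renaming (lookup to lookupAll; tabulate to tabulateAll)
open import Data.List.Relation.Unary.All.Properties using (¬All⇒Any¬)
open import Data.List.Relation.Unary.AllPairs as AllPairs using (AllPairs; []; _∷_)
open import Data.List.Relation.Unary.Any using (Any; here; there; any?; index; satisfied)
open import Data.List.Relation.Unary.Any.Properties using (map⁻; lookup-index)
open import Data.List.Relation.Unary.Sorted.TotalOrder.Properties using (Sorted⇒AllPairs)
open import Data.List.Relation.Unary.Unique.Propositional using (Unique)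
open import Data.List.Relation.Unary.Unique.Propositional.Properties as Unique
  using (upTo⁺) renaming (Unique[x∷xs]⇒x∉xs to unique-head)
import Data.List.Sort as Sort
open import Data.Maybe using (Maybe; just; nothing)
open import Data.Nat
  using (ℕ; zero; suc; _+_; _*_; _∸_; _^_; _≤_; _<_; z≤n; s≤s; NonZero)
open import Data.Nat.DivMod using (_/_; _%_; m≡m%n+[m/n]*n; m%n<n)
open import Data.Nat.Logarithm using (⌊log₂_⌋; ⌊log₂⌋-mono-≤; ⌊log₂[2^n]⌋≡n)
open import Data.Nat.Properties
open import Data.List.Membership.DecPropositional _≟_ using (_∈?_)
open import Data.List.Relation.Unary.Unique.DecPropositional.Properties _≟_ using (deduplicate-!)
open import Data.Nat.Solver using (module +-*-Solver)
open import Data.Product using (∃; _×_; _,_; proj₁; proj₂)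
open import Data.Product.Properties using (≡-dec)
open import Data.Sum using (_⊎_; inj₁; inj₂; [_,_]′)
open import Data.Vec using (Vec; []; _∷_; toList)
open import Data.Vec.Properties using (length-toList)
open import Function using (_∘_; id)
open import Relation.Binary.Bundles using (DecTotalOrder)
import Relation.Binary.Construct.Flip.EqAndOrd as Flip
import Relation.Binary.Construct.On as On
open import Relation.Binary.Definitions using (tri<; tri≈; tri>)
open import Relation.Binary.PropositionalEquality hiding ([_])
open import Relation.Nullary using (¬_; Dec; yes; no; does)
open import Relation.Nullary.Decidable
  using (_⊎-dec_; _×-dec_; _→-dec_; ¬?; map′; dec-true; dec-false)

-- Counting with duplicate-free lists

unique-⊆-length : ∀ {A : Set} {xs ys : List A} → Unique xs → (∀ {x} → x ∈ xs → x ∈ ys) →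
                  length xs ≤ length ys
unique-⊆-length []         sub = z≤n
unique-⊆-length {ys = ys} (_∷_ {x} {xs} x≢ u) sub with ∈-∃++ (sub (here refl))
... | as , bs , refl =
  ≤-trans (s≤s (unique-⊆-length u sub′)) (≤-reflexive len)
  where
  sub′ : ∀ {z} → z ∈ xs → z ∈ as ++ bs
  sub′ z∈ with ∈-++⁻ as (sub (there z∈))
  ... | inj₁ p           = ∈-++⁺ˡ p
  ... | inj₂ (here refl) = ⊥-elim (lookupAll x≢ z∈ refl)
  ... | inj₂ (there p)   = ∈-++⁺ʳ as p
  len : suc (length (as ++ bs)) ≡ length (as ++ x ∷ bs)
  len rewrite length-++ as {bs} | length-++ as {x ∷ bs} = sym (+-suc (length as) (length bs))

unique-∷ : ∀ {A : Set} {x : A} {xs} → x ∉ xs → Unique xs → Unique (x ∷ xs)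
unique-∷ x∉ u = tabulateAll (λ { y∈ refl → x∉ y∈ }) ∷ u

unique-map : ∀ {A B : Set} (f : A → B) {xs} →
             (∀ {x y} → x ∈ xs → y ∈ xs → f x ≡ f y → x ≡ y) → Unique xs → Unique (map f xs)
unique-map f inj []        = []
unique-map f inj u@(_ ∷ us) =
  unique-∷ (λ p → let (z , z∈ , eq) = ∈-map⁻ f p in
             unique-head u (subst (_∈ _) (sym (inj (here refl) (there z∈) eq)) z∈))
           (unique-map f (λ p q → inj (there p) (there q)) us)

fresh : ∀ {D} (xs : List ℕ) → length xs < D → ∃ λ a → a < D × a ∉ xs
fresh {D} xs len with all? (_∈? xs) (upTo D)
... | yes all = ⊥-elim (<-irrefl refl (≤-<-trans
      (≤-trans (≤-reflexive (sym (length-upTo D))) (unique-⊆-length (upTo⁺ D) (lookupAll all))) len))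
... | no ¬all with find (¬All⇒Any¬ (_∈? xs) (upTo D) ¬all)
... | a , a∈ , a∉ = a , ∈-upTo⁻ a∈ , a∉

-- Arcs, proper colourings and missing colours

tail head : Edge → ℕ
tail = proj₁
head = proj₂

_≟ₑ_ : (e f : Edge) → Dec (e ≡ f)
_≟ₑ_ = ≡-dec _≟_ _≟_

Inc : ℕ → Edge → Set
Inc v e = v ≡ tail e ⊎ v ≡ head e

inc? : ∀ v e → Dec (Inc v e)
inc? v e = (v ≟ tail e) ⊎-dec (v ≟ head e)

incident out-arcs in-arcs : ℕ → List Edge → List Edge
incident v = filter (inc? v)
out-arcs v = filter (λ e → v ≟ tail e)
in-arcs  v = filter (λ e → v ≟ head e)

-- Properness as injectivity at every vertex. A colouring is a function on all pairs of numbers, of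
-- which only the values on `E` matter, so that `E` can grow or be split without changing its type.
Proper : List Edge → (Edge → ℕ) → Set
Proper E c = ∀ {v e f} → e ∈ E → f ∈ E → Inc v e → Inc v f → c e ≡ c f → e ≡ f

Miss : List Edge → (Edge → ℕ) → ℕ → ℕ → Set
Miss E c v a = ∀ {e} → e ∈ E → Inc v e → c e ≢ a

colours : List Edge → (Edge → ℕ) → ℕ → List ℕ
colours E c v = map c (incident v E)

∉⇒Miss : ∀ {E c v a} → a ∉ colours E c v → Miss E c v a
∉⇒Miss {c = c} {v} a∉ e∈ i refl = a∉ (∈-map⁺ c (∈-filter⁺ (inc? v) e∈ i))

search : ∀ E (c : Edge → ℕ) v a → Miss E c v a ⊎ (∃ λ e → e ∈ E × Inc v e × c e ≡ a)
search E c v a with a ∈? colours E c v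
... | no a∉ = inj₁ (∉⇒Miss a∉)
... | yes a∈ with ∈-map⁻ c a∈
... | e , e∈ , refl = inj₂ (e , proj₁ p , proj₂ p , refl)
  where p = ∈-filter⁻ (inc? v) {xs = E} e∈

-- Kempe changes and edge colouring with at least 2d colours

module Kempe (E : List Edge) (c : Edge → ℕ) (proper : Proper E c) where

  Closed : List ℕ → ℕ → ℕ → Set
  Closed S v a = ∀ {e w} → e ∈ E → Inc v e → c e ≡ a → Inc w e → w ∈ S

  vertices : List ℕ
  vertices = map tail E ++ map head E

  inc-vertex : ∀ {v e} → e ∈ E → Inc v e → v ∈ vertices
  inc-vertex e∈ (inj₁ refl) = ∈-++⁺ˡ (∈-map⁺ tail e∈)
  inc-vertex e∈ (inj₂ refl) = ∈-++⁺ʳ (map tail E) (∈-map⁺ head e∈)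

  other : ∀ {v e} → Inc v e → ∃ λ w → Inc w e × (∀ {u} → Inc u e → u ≡ v ⊎ u ≡ w)
  other {e = a , b} (inj₁ refl) = b , inj₂ refl , id
  other {e = a , b} (inj₂ refl) = a , inj₁ refl , λ { (inj₁ p) → inj₂ p ; (inj₂ p) → inj₁ p }

  Pair : (α γ k : ℕ) → Set
  Pair α γ k = k ≡ α ⊎ k ≡ γ

  module _ (α γ y : ℕ) where

    -- A vertex inside an alternating path sees both colours, so among the vertices of the path only
    -- `y` and the last one can miss `α` or `γ`.
    Inner : ℕ → Set
    Inner v = v ≡ y ⊎ (∀ {k} → Pair α γ k → ¬ Miss E c v k)

    -- The vertex set of the αγ-path from y; all but its last vertex h are inner.
    record Path : Set where
      field
        S      : List ℕ
        h      : ℕ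
        y∈S    : y ∈ S
        inner  : ∀ {v} → v ∈ S → v ≡ h ⊎ Inner v
        closed : ∀ {v k} → v ∈ S → Pair α γ k → Closed S v k

    -- The path grows at `h`: `a` is the colour by which `h` was entered, `b` the one by which the
    -- path leaves, and the two swap at every step. The vertices of `rest` are finished. The fuel
    -- `n` suffices because the visited vertices are distinct and lie in `y ∷ vertices`.
    walk : ∀ n h rest a b →
      length (y ∷ vertices) < n + length (h ∷ rest) →
      (∀ {k} → Pair α γ k → k ≡ a ⊎ k ≡ b) →
      Unique (h ∷ rest) → (∀ {v} → v ∈ h ∷ rest → v ∈ y ∷ vertices) →
      y ∈ h ∷ rest →
      (∀ {v} → v ∈ rest → Inner v) →
      (∀ {v k} → v ∈ rest → Pair α γ k → Closed (h ∷ rest) v k) →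
      (h ≡ y ⊎ ¬ Miss E c h a) → Closed (h ∷ rest) h a → Path
    walk zero h rest a b len ab uniq sub y∈ inn clo ha cla =
      ⊥-elim (<-irrefl refl (<-≤-trans len (unique-⊆-length uniq sub)))
    walk (suc n) h rest a b len ab uniq sub y∈ inn clo ha cla with search E c h b
    ... | inj₁ miss = record { S = h ∷ rest ; h = h ; y∈S = y∈
        ; inner = λ { (here p) → inj₁ p ; (there p) → inj₂ (inn p) }
        ; closed = λ { (here refl) k∈ → cl (ab k∈) ; (there p) → clo p } }
      where
      cl : ∀ {k} → k ≡ a ⊎ k ≡ b → Closed (h ∷ rest) h k
      cl (inj₁ refl) = cla
      cl (inj₂ refl) = λ f∈ hf cf _ → ⊥-elim (miss f∈ hf cf)
    ... | inj₂ (e , e∈ , he , refl) with other {e = e} he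
    ... | w , we , only with w ∈? (h ∷ rest)
    -- The walk also stops when the next edge leads back to a visited vertex: the visited set is
    -- then closed under both colours at `h`.
    ... | yes w∈ = record { S = h ∷ rest ; h = h ; y∈S = y∈
        ; inner = λ { (here p) → inj₁ p ; (there p) → inj₂ (inn p) }
        ; closed = λ { (here refl) k∈ → cl (ab k∈) ; (there p) → clo p } }
      where
      cl : ∀ {k} → k ≡ a ⊎ k ≡ c e → Closed (h ∷ rest) h k
      cl (inj₁ refl) = cla
      cl (inj₂ refl) f∈ hf cf uf with proper f∈ e∈ hf he cf
      ... | refl with only uf
      ... | inj₁ refl = here refl
      ... | inj₂ refl = w∈
    ... | no w∉ =
      walk n w (h ∷ rest) (c e) a
        (≤-trans len (≤-reflexive (sym (+-suc n _))))
        (λ p → [ inj₂ , inj₁ ]′ (ab p))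
        (unique-∷ w∉ uniq)
        (λ { (here refl) → there (inc-vertex e∈ we) ; (there p) → sub p })
        (there y∈)
        (λ { (here refl) → head-inner ha ; (there p) → inn p })
        (λ { (here refl) k∈ → cl (ab k∈) ; (there p) k∈ f∈ vf cf uf → there (clo p k∈ f∈ vf cf uf) })
        (inj₂ (λ miss → miss e∈ we refl))
        clw
      where
      ends : ∀ {u} → Inc u e → u ∈ w ∷ h ∷ rest
      ends ue with only ue
      ... | inj₁ refl = there (here refl)
      ... | inj₂ refl = here refl
      clw : Closed (w ∷ h ∷ rest) w (c e)
      clw f∈ wf cf uf with proper f∈ e∈ wf we cf
      ... | refl = ends uf
      cl : ∀ {k} → k ≡ a ⊎ k ≡ c e → Closed (w ∷ h ∷ rest) h k
      cl (inj₁ refl) f∈ hf cf uf = there (cla f∈ hf cf uf)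
      cl (inj₂ refl) f∈ hf cf uf with proper f∈ e∈ hf he cf
      ... | refl = ends uf
      head-inner : h ≡ y ⊎ ¬ Miss E c h a → Inner h
      head-inner (inj₁ p)  = inj₁ p
      head-inner (inj₂ ¬m) = inj₂ (λ k∈ → f (ab k∈))
        where
        f : ∀ {k} → k ≡ a ⊎ k ≡ c e → ¬ Miss E c h k
        f (inj₁ refl) = ¬m
        f (inj₂ refl) m = m e∈ he refl

    path : Miss E c y γ → Path
    path miss = walk (length (y ∷ vertices)) y [] γ α (m<m+n _ (s≤s z≤n))
      (λ { (inj₁ p) → inj₂ p ; (inj₂ p) → inj₁ p })
      (unique-∷ (λ ()) []) (λ { (here p) → here p }) (here refl) (λ ()) (λ ()) (inj₁ refl)
      (λ f∈ yf cf _ → ⊥-elim (miss f∈ yf cf))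

  -- `s` is the characteristic function of a union of αγ-components. In this form the complement is
  -- again such a union.
  Invariant : (α γ : ℕ) → (ℕ → Bool) → Set
  Invariant α γ s = ∀ {e u v} → e ∈ E → Pair α γ (c e) → Inc u e → Inc v e → s u ≡ s v

  -- At most one of x and z is on the path from y, since both would be its last vertex.
  separate : ∀ {α γ x y z} → x ≢ y → x ≢ z → y ≢ z →
    Miss E c x α → Miss E c y γ → Miss E c z γ →
    ∃ λ s → Invariant α γ s × s x ≡ false × (s y ≡ true ⊎ s z ≡ true)
  separate {α} {γ} {x} {y} {z} x≢y x≢z y≢z mx my mz with path α γ y my
  ... | record { S = S ; h = h ; y∈S = y∈S ; inner = inner ; closed = closed } =
    choose (x ∈? S) (z ∈? S)
    where
    in-S : ℕ → Bool
    in-S v = does (v ∈? S)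
    inv : Invariant α γ in-S
    inv {u = u} {v} e∈ ce ue ve with u ∈? S | v ∈? S
    ... | yes _ | yes _ = refl
    ... | no _  | no _  = refl
    ... | yes p | no q  = ⊥-elim (q (closed p ce e∈ ue refl ve))
    ... | no p  | yes q = ⊥-elim (p (closed q ce e∈ ve refl ue))
    not-inv : Invariant α γ (not ∘ in-S)
    not-inv e∈ ce ue ve = cong not (inv e∈ ce ue ve)
    end : ∀ {v k} → v ∈ S → v ≢ y → Pair α γ k → Miss E c v k → v ≡ h
    end v∈ v≢y k∈ m with inner v∈
    ... | inj₁ p        = p
    ... | inj₂ (inj₁ p) = ⊥-elim (v≢y p)
    ... | inj₂ (inj₂ f) = ⊥-elim (f k∈ m)
    choose : Dec (x ∈ S) → Dec (z ∈ S) → _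
    choose (no x∉) _ = in-S , (λ {e} {u} {v} → inv {e} {u} {v}) , dec-false (x ∈? S) x∉ , inj₁ (dec-true (y ∈? S) y∈S)
    -- Here the Kempe change is made off the path, on the side that contains `z`.
    choose (yes x∈) (no z∉) = not ∘ in-S , (λ {e} {u} {v} → not-inv {e} {u} {v})
      , cong not (dec-true (x ∈? S) x∈) , inj₂ (cong not (dec-false (z ∈? S) z∉))
    choose (yes x∈) (yes z∈) =
      ⊥-elim (x≢z (trans (end x∈ x≢y (inj₁ refl) mx) (sym (end z∈ (y≢z ∘ sym) (inj₂ refl) mz))))

  module Swap (α γ : ℕ) (s : ℕ → Bool) (inv : Invariant α γ s) where

    swap : ℕ → ℕ
    swap n with n ≟ α | n ≟ γ
    ... | yes _ | _     = γ
    ... | no _  | yes _ = α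
    ... | no _  | no _  = n

    swap-α : swap α ≡ γ
    swap-α with α ≟ α | α ≟ γ
    ... | yes _ | _ = refl
    ... | no p  | _ = ⊥-elim (p refl)

    swap-γ : swap γ ≡ α
    swap-γ with γ ≟ α | γ ≟ γ
    ... | yes p | _     = p
    ... | no _  | yes _ = refl
    ... | no _  | no p  = ⊥-elim (p refl)

    swap-other : ∀ {n} → ¬ Pair α γ n → swap n ≡ n
    swap-other {n} ¬p with n ≟ α | n ≟ γ
    ... | yes p | _     = ⊥-elim (¬p (inj₁ p))
    ... | no _  | yes p = ⊥-elim (¬p (inj₂ p))
    ... | no _  | no _  = refl

    pair? : ∀ n → Dec (Pair α γ n)
    pair? n = (n ≟ α) ⊎-dec (n ≟ γ)

    swap-involutive : ∀ n → swap (swap n) ≡ n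
    swap-involutive n with pair? n
    ... | yes (inj₁ refl) = trans (cong swap swap-α) swap-γ
    ... | yes (inj₂ refl) = trans (cong swap swap-γ) swap-α
    ... | no ¬p           = trans (cong swap (swap-other ¬p)) (swap-other ¬p)

    swap-< : ∀ {D n} → α < D → γ < D → n < D → swap n < D
    swap-< {n = n} α<D γ<D n<D with n ≟ α | n ≟ γ
    ... | yes _ | _     = γ<D
    ... | no _  | yes _ = α<D
    ... | no _  | no _  = n<D

    recolor : Bool → ℕ → ℕ
    recolor b n = if b then swap n else n

    recolor-injective : ∀ b {m n} → recolor b m ≡ recolor b n → m ≡ n
    recolor-injective true  {m} {n} eq =
      trans (sym (swap-involutive m)) (trans (cong swap eq) (swap-involutive n))
    recolor-injective false eq = eq

    recolor-other : ∀ b {n} → ¬ Pair α γ n → recolor b n ≡ n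
    recolor-other true  = swap-other
    recolor-other false _ = refl

    c′ : Edge → ℕ
    c′ e = recolor (s (tail e)) (c e)

    -- An edge coloured `α` or `γ` has both ends on the same side, and `swap` fixes every other
    -- colour; so either end may decide whether the edge is recoloured.
    c′-at : ∀ {v e} → e ∈ E → Inc v e → c′ e ≡ recolor (s v) (c e)
    c′-at {v} {e} e∈ ve with pair? (c e)
    ... | yes p = cong (λ b → recolor b (c e)) (inv e∈ p (inj₁ refl) ve)
    ... | no ¬p = trans (recolor-other (s (tail e)) ¬p) (sym (recolor-other (s v) ¬p))

    proper′ : Proper E c′
    proper′ {v} e∈ f∈ ve vf eq = proper e∈ f∈ ve vf
      (recolor-injective (s v) (trans (sym (c′-at e∈ ve)) (trans eq (c′-at f∈ vf))))

    c′-< : ∀ {D} → α < D → γ < D → (∀ {e} → e ∈ E → c e < D) → ∀ {e} → e ∈ E → c′ e < D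
    c′-< α<D γ<D c<D {e} e∈ with s (tail e)
    ... | true  = swap-< α<D γ<D (c<D e∈)
    ... | false = c<D e∈

    miss-in : ∀ {v} → s v ≡ true → Miss E c v γ → Miss E c′ v α
    miss-in {v} sv m {e} e∈ ve eq = m e∈ ve (recolor-injective true
      (trans (trans (cong (λ b → recolor b (c e)) (sym sv)) (sym (c′-at e∈ ve))) (trans eq (sym swap-γ))))

    miss-out : ∀ {v a} → s v ≡ false → Miss E c v a → Miss E c′ v a
    miss-out {v} sv m {e} e∈ ve eq =
      m e∈ ve (trans (trans (cong (λ b → recolor b (c e)) (sym sv)) (sym (c′-at e∈ ve))) eq)

    miss-other : ∀ {v a} → ¬ Pair α γ a → Miss E c v a → Miss E c′ v a
    miss-other {v} {a} ¬p m {e} e∈ ve eq = m e∈ ve (recolor-injective (s v)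
      (trans (sym (c′-at e∈ ve)) (trans eq (sym (recolor-other (s v) ¬p)))))

-- Extending a colouring by one arc

_[_≔_] : (Edge → ℕ) → Edge → ℕ → Edge → ℕ
(c [ e ≔ a ]) f = if does (f ≟ₑ e) then a else c f

update-< : ∀ {E} c {e a D} → a < D → (∀ {f} → f ∈ E → c f < D) →
           ∀ {f} → f ∈ e ∷ E → (c [ e ≔ a ]) f < D
update-< c {e} a<D c<D {f} f∈ with f ≟ₑ e | f∈
... | yes _ | _        = a<D
... | no p  | here q   = ⊥-elim (p q)
... | no _  | there f∈ = c<D f∈

extend : ∀ {E c x y a} → Proper E c → Miss E c x a → Miss E c y a →
         Proper ((x , y) ∷ E) (c [ x , y ≔ a ])
extend {E} {c} {x} {y} {a} pr mx my {v} {e} {f} e∈ f∈ ve vf eq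
  with e ≟ₑ (x , y) | f ≟ₑ (x , y) | e∈ | f∈
... | yes p | yes q | _        | _        = trans p (sym q)
... | no p  | _     | here q   | _        = ⊥-elim (p q)
... | _     | no p  | _        | here q   = ⊥-elim (p q)
... | no _  | no _  | there e∈ | there f∈ = pr e∈ f∈ ve vf eq
... | yes refl | no _ | _ | there f∈ = ⊥-elim (clash ve vf)
  where
  clash : Inc v (x , y) → Inc v f → _
  clash (inj₁ refl) vf = mx f∈ vf (sym eq)
  clash (inj₂ refl) vf = my f∈ vf (sym eq)
... | no _ | yes refl | there e∈ | _ = ⊥-elim (clash vf ve)
  where
  clash : Inc v (x , y) → Inc v e → _
  clash (inj₁ refl) ve = mx e∈ ve eq
  clash (inj₂ refl) ve = my e∈ ve eq

proper-⊆ : ∀ {E E′ c} → (∀ {e} → e ∈ E → e ∈ E′) → Proper E′ c → Proper E c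
proper-⊆ sub pr e∈ f∈ = pr (sub e∈) (sub f∈)

Colouring : List Edge → ℕ → Set
Colouring E D = ∃ λ c → Proper E c × (∀ {e} → e ∈ E → c e < D)

-- Recolour xz with α and give its former colour β to xy.
shift : ∀ {E c D α β x y z} → Proper E c → (∀ {e} → e ∈ E → c e < D) → α < D → β < D →
  (x , z) ∈ E → c (x , z) ≡ β → y ≢ x → y ≢ z →
  Miss E c x α → Miss E c z α → Miss E c y β → Colouring ((x , y) ∷ E) D
shift {E} {c} {D} {α} {β} {x} {y} {z} pr c<D α<D β<D xz∈ cxz y≢x y≢z mx mz my =
  c₁ [ x , y ≔ β ] , extend pr₁ mx₁ my₁ , update-< c₁ β<D (λ e∈ → update-< c α<D c<D (there e∈))
  where
  c₁ : Edge → ℕ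
  c₁ = c [ x , z ≔ α ]
  pr₁ : Proper E c₁
  pr₁ = proper-⊆ there (extend pr mx mz)
  mx₁ : Miss E c₁ x β
  mx₁ {e} e∈ xe eq with e ≟ₑ (x , z)
  ... | yes refl = mx xz∈ (inj₁ refl) (trans cxz (sym eq))
  ... | no p     = p (pr e∈ xz∈ xe (inj₁ refl) (trans eq (sym cxz)))
  my₁ : Miss E c₁ y β
  my₁ {e} e∈ ye eq with e ≟ₑ (x , z)
  ... | yes refl = [ y≢x , y≢z ]′ ye
  ... | no p     = my e∈ ye eq

module _ (r : ℕ → ℕ) (d D : ℕ) (2d≤D : d + d ≤ D) where

  -- Since x has the largest rank among the tails, every out-neighbour of x has only
  -- in-arcs, hence at most d colours.  Pick α missing at x, then β missing at y and
  -- on no in-arc of x; unless β is missing at x, it is the colour of an arc xz.  Pick γ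
  -- missing at y and z: a Kempe change frees α at y or at z without using it at x.
  add-arc : ∀ {x y E} → Unique ((x , y) ∷ E) →
    (∀ {e} → e ∈ (x , y) ∷ E → r (tail e) < r (head e)) →
    (∀ {e} → e ∈ E → r (tail e) ≤ r x) →
    (∀ v → length (in-arcs v ((x , y) ∷ E)) ≤ d) →
    (∀ v → length (incident v ((x , y) ∷ E)) ≤ D) →
    Colouring E D → Colouring ((x , y) ∷ E) D
  add-arc {x} {y} {E} uniq up top indeg deg (c , pr , c<D) = go
    where
    xy∉ : (x , y) ∉ E
    xy∉ = unique-head uniq
    uniqE : Unique E
    uniqE = AllPairs.tail uniq

    -- x has the largest rank among the tails, so the heads of its arcs are not tails.
    only-in : ∀ {w v e} → (x , w) ∈ (x , y) ∷ E → v ≡ w → e ∈ E → Inc v e → w ≡ head e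
    only-in xw∈ refl e∈ (inj₁ refl) = ⊥-elim (<-irrefl refl (<-≤-trans (up xw∈) (top e∈)))
    only-in xw∈ refl e∈ (inj₂ p)    = p

    deg-x : length (colours E c x) < D
    deg-x = begin-strict
      length (colours E c x)                ≡⟨ length-map c (incident x E) ⟩
      length (incident x E)                <⟨ unique-⊆-length
        (unique-∷ (xy∉ ∘ proj₁ ∘ ∈-filter⁻ (inc? x)) (Unique.filter⁺ (inc? x) uniqE))
        (λ { (here refl) → ∈-filter⁺ (inc? x) (here refl) (inj₁ refl)
           ; (there p) → let (e∈ , i) = ∈-filter⁻ (inc? x) {xs = E} p in ∈-filter⁺ (inc? x) (there e∈) i }) ⟩
      length (incident x ((x , y) ∷ E))    ≤⟨ deg x ⟩
      D                                    ∎
      where open ≤-Reasoning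

    -- All edges of `E` at `y` are in-arcs, and `xy` is one in-arc more: hence the strict
    -- inequality.
    deg-y : length (colours E c y) < d
    deg-y = begin-strict
      length (colours E c y)                ≡⟨ length-map c (incident y E) ⟩
      length (incident y E)                <⟨ unique-⊆-length
        (unique-∷ (xy∉ ∘ proj₁ ∘ ∈-filter⁻ (inc? y)) (Unique.filter⁺ (inc? y) uniqE))
        (λ { (here refl) → ∈-filter⁺ (λ e → y ≟ head e) (here refl) refl
           ; (there p) → let (e∈ , i) = ∈-filter⁻ (inc? y) {xs = E} p in
               ∈-filter⁺ (λ e → y ≟ head e) (there e∈) (only-in (here refl) refl e∈ i) }) ⟩
      length (in-arcs y ((x , y) ∷ E))     ≤⟨ indeg y ⟩
      d                                    ∎
      where open ≤-Reasoning

    deg-z : ∀ {z} → (x , z) ∈ E → length (colours E c z) ≤ d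
    deg-z {z} xz∈ = begin
      length (colours E c z)                ≡⟨ length-map c (incident z E) ⟩
      length (incident z E)                ≤⟨ unique-⊆-length (Unique.filter⁺ (inc? z) uniqE)
        (λ p → let (e∈ , i) = ∈-filter⁻ (inc? z) {xs = E} p in
               ∈-filter⁺ (λ e → z ≟ head e) (there e∈) (only-in (there xz∈) refl e∈ i)) ⟩
      length (in-arcs z ((x , y) ∷ E))     ≤⟨ indeg z ⟩
      d                                    ∎
      where open ≤-Reasoning

    indeg-x : length (map c (in-arcs x E)) ≤ d
    indeg-x = begin
      length (map c (in-arcs x E))         ≡⟨ length-map c (in-arcs x E) ⟩
      length (in-arcs x E)                 ≤⟨ unique-⊆-length (Unique.filter⁺ (λ e → x ≟ head e) uniqE)
        (λ p → let (e∈ , i) = ∈-filter⁻ (λ e → x ≟ head e) {xs = E} p in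
               ∈-filter⁺ (λ e → x ≟ head e) (there e∈) i) ⟩
      length (in-arcs x ((x , y) ∷ E))     ≤⟨ indeg x ⟩
      d                                    ∎
      where open ≤-Reasoning

    -- Fewer than `d` colours at `y` and at most `d` others cannot exhaust `D ≥ 2d` colours.
    both : ∀ {xs} → length xs ≤ d → length (colours E c y ++ xs) < D
    both {xs} le = <-≤-trans
      (≤-<-trans (≤-reflexive (length-++ (colours E c y))) (+-mono-<-≤ deg-y le)) 2d≤D

    go : Colouring ((x , y) ∷ E) D
    go with fresh _ deg-x | fresh _ (both indeg-x)
    ... | α , α<D , α∉ | β , β<D , β∉ with search E c x β
    ... | inj₁ mx =
      c [ x , y ≔ β ] , extend pr mx (∉⇒Miss (β∉ ∘ ∈-++⁺ˡ)) , update-< c β<D c<D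
    ... | inj₂ ((x′ , z) , e∈ , inj₂ refl , cβ) = ⊥-elim (β∉ (∈-++⁺ʳ (colours E c y)
      (subst (_∈ _) cβ (∈-map⁺ c (∈-filter⁺ (λ e → x ≟ head e) e∈ refl)))))
    ... | inj₂ ((.x , z) , xz∈ , inj₁ refl , cβ) with fresh _ (both (deg-z xz∈))
    ... | γ , γ<D , γ∉ = finish (α ≟ γ)
      where
      mx : Miss E c x α
      mx = ∉⇒Miss α∉
      my : Miss E c y γ
      my = ∉⇒Miss (γ∉ ∘ ∈-++⁺ˡ)
      mz : Miss E c z γ
      mz = ∉⇒Miss (γ∉ ∘ ∈-++⁺ʳ (colours E c y))
      myβ : Miss E c y β
      myβ = ∉⇒Miss (β∉ ∘ ∈-++⁺ˡ)
      x≢y : x ≢ y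
      x≢y refl = <-irrefl refl (up (here refl))
      x≢z : x ≢ z
      x≢z refl = <-irrefl refl (up (there xz∈))
      y≢z : y ≢ z
      y≢z refl = xy∉ xz∈
      finish : Dec (α ≡ γ) → Colouring ((x , y) ∷ E) D
      finish (yes refl) = c [ x , y ≔ α ] , extend pr mx my , update-< c α<D c<D
      finish (no α≢γ) with Kempe.separate E c pr x≢y x≢z y≢z mx my mz
      ... | s , inv , sx , inj₁ sy =
        c′ [ x , y ≔ α ] , extend proper′ (miss-out sx mx) (miss-in sy my)
        , update-< c′ α<D (c′-< α<D γ<D c<D)
        where open Kempe.Swap E c pr α γ s inv
      ... | s , inv , sx , inj₂ sz =
        shift proper′ (c′-< α<D γ<D c<D) α<D β<D xz∈
          (trans (c′-at xz∈ (inj₁ refl)) (trans (recolor-other (s x) (subst (λ n → ¬ (n ≡ α ⊎ n ≡ γ)) (sym cβ) β∉αγ)) cβ))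
          (x≢y ∘ sym) y≢z (miss-out sx mx) (miss-in sz mz) (miss-other β∉αγ myβ)
        where
        open Kempe.Swap E c pr α γ s inv
        -- The arc `xz` has colour `β`, whereas `α` is missing at `x` and `γ` at `z`; so the Kempe
        -- change leaves the colour `β` in place.
        β∉αγ : ¬ (β ≡ α ⊎ β ≡ γ)
        β∉αγ (inj₁ p) = mx xz∈ (inj₁ refl) (trans cβ p)
        β∉αγ (inj₂ p) = mz xz∈ (inj₂ refl) (trans cβ p)

  -- The head of the list is inserted last, so descending rank of the tails means that each new arc
  -- has the largest tail rank so far, as `add-arc` requires.
  colour-sorted : ∀ E → AllPairs (λ e f → r (tail f) ≤ r (tail e)) E → Unique E →
    (∀ {e} → e ∈ E → r (tail e) < r (head e)) →
    (∀ v → length (in-arcs v E) ≤ d) → (∀ v → length (incident v E) ≤ D) → Colouring E D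
  colour-sorted [] _ _ _ _ _ = (λ _ → 0) , (λ ()) , (λ ())
  colour-sorted ((x , y) ∷ E) (top ∷ sorted) u up indeg deg =
    add-arc u up (lookupAll top) indeg deg
      (colour-sorted E sorted (AllPairs.tail u) (up ∘ there)
        (λ v → ≤-trans (fewer (λ e → v ≟ head e)) (indeg v))
        (λ v → ≤-trans (fewer (inc? v)) (deg v)))
    where
    fewer : ∀ {P : Edge → Set} (P? : ∀ e → Dec (P e)) →
            length (filter P? E) ≤ length (filter P? ((x , y) ∷ E))
    fewer P? = unique-⊆-length (Unique.filter⁺ P? (AllPairs.tail u))
      (λ p → let (e∈ , pe) = ∈-filter⁻ P? {xs = E} p in ∈-filter⁺ P? (there e∈) pe)

  by-tail : DecTotalOrder _ _ _
  by-tail = On.decTotalOrder (Flip.decTotalOrder ≤-decTotalOrder) (r ∘ tail)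

  open Sort by-tail using (sort; sort-↭; sort-↗)

  -- Sorting by descending tail rank provides the insertion order; degrees and properness are
  -- invariant under permutation.
  class-one : ∀ E → Unique E → (∀ {e} → e ∈ E → r (tail e) < r (head e)) →
    (∀ v → length (in-arcs v E) ≤ d) → (∀ v → length (incident v E) ≤ D) → Colouring E D
  class-one E u up indeg deg
    with colour-sorted (sort E) (Sorted⇒AllPairs (DecTotalOrder.totalOrder by-tail) (sort-↗ E))
      (Permutation.Unique-resp-↭ (setoid Edge) (↭⇒↭ₛ (↭-sym (sort-↭ E))) u)
      (λ e∈ → up (∈-resp-↭ (sort-↭ E) e∈))
      (λ v → ≤-trans (≤-reflexive (↭-length (filter-↭ (λ e → v ≟ head e) (sort-↭ E)))) (indeg v))
      (λ v → ≤-trans (≤-reflexive (↭-length (filter-↭ (inc? v) (sort-↭ E)))) (deg v))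
  ... | c , pr , c<D = c , proper-⊆ (∈-resp-↭ (↭-sym (sort-↭ E))) pr
      , λ e∈ → c<D (∈-resp-↭ (↭-sym (sort-↭ E)) e∈)

-- First positions in lists, and counting in intervals

module _ {A : Set} {P : A → Set} (P? : ∀ x → Dec (P x)) where

  -- The value is the length of the list if no entry qualifies; ranks of vertices outside an order
  -- are thus defined and bounded.
  firstIndex : List A → ℕ
  firstIndex []       = 0
  firstIndex (x ∷ xs) = if does (P? x) then 0 else suc (firstIndex xs)

  firstIndex-lookup : ∀ {xs} → Any P xs →
    ∃ λ (i : Fin (length xs)) → toℕ i ≡ firstIndex xs × P (lookup xs i)
  firstIndex-lookup {x ∷ xs} p with P? x | p
  ... | yes px | _       = zero , refl , px
  ... | no ¬px | here px = ⊥-elim (¬px px)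
  ... | no _   | there p = let (i , eq , pi) = firstIndex-lookup p in suc i , cong suc eq , pi

  firstIndex-take : ∀ {xs n} → Any P xs → firstIndex xs < n → Any P (take n xs)
  firstIndex-take {x ∷ xs} {suc n} p lt with P? x | p
  ... | yes px | _       = here px
  ... | no ¬px | here px = ⊥-elim (¬px px)
  ... | no _   | there p = there (firstIndex-take p (≤-pred lt))

  firstIndex-≤ : ∀ xs → firstIndex xs ≤ length xs
  firstIndex-≤ []       = z≤n
  firstIndex-≤ (x ∷ xs) with P? x
  ... | yes _ = z≤n
  ... | no _  = s≤s (firstIndex-≤ xs)

  firstIndex-< : ∀ {xs} → Any P xs → firstIndex xs < length xs
  firstIndex-< p = let (i , eq , _) = firstIndex-lookup p in subst (_< _) eq (toℕ<n i)

  filter-length-mono : ∀ {Q : A → Set} (Q? : ∀ x → Dec (Q x)) {xs} → Unique xs →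
    (∀ {x} → x ∈ xs → P x → Q x) → length (filter P? xs) ≤ length (filter Q? xs)
  filter-length-mono Q? {xs} u imp = unique-⊆-length (Unique.filter⁺ P? u)
    (λ p → let (x∈ , px) = ∈-filter⁻ P? {xs = xs} p in ∈-filter⁺ Q? x∈ (imp x∈ px))

module _ {A : Set} (_≟ₐ_ : (x y : A) → Dec (x ≡ y)) where

  firstIndex-injective : ∀ {xs x y} → x ∈ xs → y ∈ xs →
    firstIndex (x ≟ₐ_) xs ≡ firstIndex (y ≟ₐ_) xs → x ≡ y
  firstIndex-injective {xs} {x} {y} x∈ y∈ eq
    with firstIndex-lookup (x ≟ₐ_) {xs} x∈ | firstIndex-lookup (y ≟ₐ_) {xs} y∈
  ... | i , eqᵢ , xᵢ | j , eqⱼ , yⱼ =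
    trans xᵢ (trans (cong (lookup xs) (toℕ-injective (trans eqᵢ (trans eq (sym eqⱼ))))) (sym yⱼ))

unique-interval : ∀ {xs a b} → Unique xs → (∀ {x} → x ∈ xs → a ≤ x × x < b) → length xs ≤ b ∸ a
unique-interval {xs} {a} {b} u bd = begin
  length xs                           ≤⟨ unique-⊆-length u (λ x∈ → mem (bd x∈)) ⟩
  length (applyUpTo (a +_) (b ∸ a))   ≡⟨ length-applyUpTo (a +_) (b ∸ a) ⟩
  b ∸ a                               ∎
  where
  open ≤-Reasoning
  mem : ∀ {x} → a ≤ x × x < b → x ∈ applyUpTo (a +_) (b ∸ a)
  mem {x} (a≤x , x<b) = subst (_∈ _) (m+[n∸m]≡n a≤x)
    (∈-applyUpTo⁺ (a +_) (∸-monoˡ-< x<b a≤x))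

-- Palettes

locate : (ℕ → ℕ) → ℕ → ℕ → ℕ
locate F i zero    = 0
locate F i (suc q) with F q ≤? i
... | yes _ = q
... | no _  = locate F i q

-- A discrete intermediate value argument: going down from `q`, where `F` exceeds `i`, the first
-- place with value at most `i` has a successor with value above `i`.
locate-spec : ∀ F i q → F 0 ≤ i → i < F q →
  let t = locate F i q in t < q × F t ≤ i × i < F (suc t)
locate-spec F i zero F0≤i i<F0 = ⊥-elim (<-irrefl refl (<-≤-trans i<F0 F0≤i))
locate-spec F i (suc q) F0≤i i<Fq with F q ≤? i
... | yes p = ≤-refl , p , i<Fq
... | no ¬p = let (t<q , l , u) = locate-spec F i q F0≤i (≰⇒> ¬p) in m<n⇒m<1+n t<q , l , u

locate-cong : ∀ {F G} → (∀ s → F s ≡ G s) → ∀ i q → locate F i q ≡ locate G i q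
locate-cong eq i zero = refl
locate-cong {F} {G} eq i (suc q) with F q ≤? i | G q ≤? i
... | yes _ | yes _ = refl
... | no _  | no _  = locate-cong eq i q
... | yes p | no ¬p = ⊥-elim (¬p (subst (_≤ i) (eq q) p))
... | no ¬p | yes p = ⊥-elim (¬p (subst (_≤ i) (sym (eq q)) p))

-- The quantity that the online algorithm can compute by itself once it knows the orientation of the
-- edges so far.
arrival : List Edge → Edge → ℕ
arrival τ e = firstIndex (e ≟ₑ_) (out-arcs (tail e) τ)

out? in? : ∀ v e → Dec _
out? v e = v ≟ tail e
in? v e = v ≟ head e

-- Palette `s` consists of the colours from `off s` up to but excluding `off (suc s)`; the first `q`
-- palettes make up the `χ` colours.
module Palettes
  (τ : List Edge) (uniq : Unique τ)
  (r : ℕ → ℕ) (up : ∀ {e} → e ∈ τ → r (tail e) < r (head e))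
  (d : ℕ) (indeg : ∀ v → length (in-arcs v τ) ≤ d)
  (χ : ℕ) (deg : ∀ v → length (incident v τ) ≤ χ)
  (off : ℕ → ℕ) (q : ℕ) (off-0 : off 0 ≡ 0) (off-q : off q ≡ χ)
  (wide : ∀ s → off s + (d + d) ≤ off (suc s))
  where

  no-loop : ∀ {v e} → e ∈ τ → v ≡ tail e → v ≡ head e → ⊥
  no-loop e∈ refl eq = <-irrefl (cong r eq) (up e∈)

  out+in : ∀ v → length (out-arcs v τ) + length (in-arcs v τ) ≤ χ
  out+in v = begin
    length (out-arcs v τ) + length (in-arcs v τ)  ≡⟨ length-++ (out-arcs v τ) ⟨
    length (out-arcs v τ ++ in-arcs v τ)          ≤⟨ unique-⊆-length
      (Unique.++⁺ (Unique.filter⁺ (out? v) uniq) (Unique.filter⁺ (in? v) uniq)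
        (λ { (o , i) → let (e∈ , p) = ∈-filter⁻ (out? v) {xs = τ} o in
                       no-loop e∈ p (proj₂ (∈-filter⁻ (in? v) {xs = τ} i)) }))
      (λ e∈ → sub (∈-++⁻ (out-arcs v τ) e∈)) ⟩
    length (incident v τ)                         ≤⟨ deg v ⟩
    χ                                             ∎
    where
    open ≤-Reasoning
    sub : ∀ {e} → e ∈ out-arcs v τ ⊎ e ∈ in-arcs v τ → e ∈ incident v τ
    sub (inj₁ o) = let (e∈ , p) = ∈-filter⁻ (out? v) {xs = τ} o in ∈-filter⁺ (inc? v) e∈ (inj₁ p)
    sub (inj₂ i) = let (e∈ , p) = ∈-filter⁻ (in? v) {xs = τ} i in ∈-filter⁺ (inc? v) e∈ (inj₂ p)

  -- The number of out-arcs that fit into the palettes below s besides the in-arcs.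
  room : (Edge → ℕ) → ℕ → ℕ → ℕ
  room t u s = off s ∸ length (filter (λ e → t e <? s) (in-arcs u τ))

  -- Recursion on the rank of the tail: stage `suc n` places the out-arcs of the vertices of rank
  -- `n`, whose in-arcs were placed at earlier stages. Arcs not yet treated carry the provisional
  -- value 0.
  palette : ℕ → Edge → ℕ
  palette zero    e = 0
  palette (suc n) e with r (tail e) ≟ n
  ... | yes _ = locate (room (palette n) (tail e)) (arrival τ e) q
  ... | no _  = palette n e

  in-palette out-palette : (Edge → ℕ) → ℕ → ℕ → List Edge
  in-palette  t u s = filter (λ e → s ≟ t e) (in-arcs u τ)
  out-palette t u s = filter (λ e → s ≟ t e) (out-arcs u τ)

  -- What the colouring needs at `u`: its degree within a palette is at most the number of colours
  -- there, and each out-arc has a palette near its arrival number.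
  Filled : (Edge → ℕ) → ℕ → Set
  Filled t u =
    (∀ s → length (out-palette t u s) + length (in-palette t u s) + off s ≤ off (suc s)) ×
    (∀ {e} → e ∈ out-arcs u τ → t e < q × off (t e) ≤ arrival τ e + d × arrival τ e < off (suc (t e)))

  filled-cong : ∀ {t t′ u} → (∀ {e} → e ∈ incident u τ → t e ≡ t′ e) → Filled t u → Filled t′ u
  filled-cong {t} {t′} {u} eq (cap , win) =
    (λ s → ≤-trans (+-monoˡ-≤ (off s) (+-mono-≤
      (filter-length-mono (λ e → s ≟ t′ e) (λ e → s ≟ t e) (Unique.filter⁺ (out? u) uniq)
        (λ e∈ p → trans p (sym (eq (out-inc e∈)))))
      (filter-length-mono (λ e → s ≟ t′ e) (λ e → s ≟ t e) (Unique.filter⁺ (in? u) uniq)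
        (λ e∈ p → trans p (sym (eq (in-inc e∈))))))) (cap s))
    , (λ {e} e∈ → subst (λ k → k < q × off k ≤ arrival τ e + d × arrival τ e < off (suc k))
         (eq (out-inc e∈)) (win e∈))
    where
    out-inc : ∀ {e} → e ∈ out-arcs u τ → e ∈ incident u τ
    out-inc o = let (e∈ , p) = ∈-filter⁻ (out? u) {xs = τ} o in ∈-filter⁺ (inc? u) e∈ (inj₁ p)
    in-inc : ∀ {e} → e ∈ in-arcs u τ → e ∈ incident u τ
    in-inc i = let (e∈ , p) = ∈-filter⁻ (in? u) {xs = τ} i in ∈-filter⁺ (inc? u) e∈ (inj₂ p)

  module Fill (t : Edge → ℕ) (u : ℕ)
    (located : ∀ {e} → e ∈ out-arcs u τ → t e ≡ locate (room t u) (arrival τ e) q) where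

    below : ℕ → ℕ
    below s = length (filter (λ e → t e <? s) (in-arcs u τ))

    below-≤ : ∀ s → below s ≤ length (in-arcs u τ)
    below-≤ s = unique-⊆-length (Unique.filter⁺ (λ e → t e <? s) (Unique.filter⁺ (in? u) uniq))
      (λ p → proj₁ (∈-filter⁻ (λ e → t e <? s) {xs = in-arcs u τ} p))

    below-suc : ∀ s → below s + length (in-palette t u s) ≤ below (suc s)
    below-suc s = begin
      below s + length (in-palette t u s)   ≡⟨ length-++ (filter below? (in-arcs u τ)) ⟨
      length (filter below? (in-arcs u τ) ++ in-palette t u s)
        ≤⟨ unique-⊆-length
             (Unique.++⁺ (Unique.filter⁺ below? uniq-in) (Unique.filter⁺ same? uniq-in)
               (λ { (l , e) → <-irrefl (sym (proj₂ (∈-filter⁻ same? {xs = in-arcs u τ} e)))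
                                       (proj₂ (∈-filter⁻ below? {xs = in-arcs u τ} l)) }))
             (λ p → sub (∈-++⁻ (filter below? (in-arcs u τ)) p)) ⟩
      below (suc s)                         ∎
      where
      open ≤-Reasoning
      below? : ∀ e → Dec (t e < s)
      below? e = t e <? s
      same? : ∀ e → Dec (s ≡ t e)
      same? e = s ≟ t e
      uniq-in : Unique (in-arcs u τ)
      uniq-in = Unique.filter⁺ (in? u) uniq
      sub : ∀ {e} → e ∈ filter below? (in-arcs u τ) ⊎ e ∈ in-palette t u s →
            e ∈ filter (λ e → t e <? suc s) (in-arcs u τ)
      sub (inj₁ p) = let (e∈ , l) = ∈-filter⁻ below? {xs = in-arcs u τ} p in
        ∈-filter⁺ (λ e → t e <? suc s) e∈ (m<n⇒m<1+n l)
      sub (inj₂ p) = let (e∈ , l) = ∈-filter⁻ same? {xs = in-arcs u τ} p in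
        ∈-filter⁺ (λ e → t e <? suc s) e∈ (s≤s (≤-reflexive (sym l)))

    arrival-<-out : ∀ {e} → e ∈ out-arcs u τ → arrival τ e < length (out-arcs u τ)
    arrival-<-out {e} e∈ with proj₂ (∈-filter⁻ (out? u) {xs = τ} e∈)
    ... | refl = firstIndex-< (e ≟ₑ_) e∈

    spec : ∀ {e} → e ∈ out-arcs u τ →
      t e < q × room t u (t e) ≤ arrival τ e × arrival τ e < room t u (suc (t e))
    spec {e} e∈ rewrite located e∈ = locate-spec (room t u) (arrival τ e) q
      (≤-trans (m∸n≤m (off 0) (below 0)) (≤-trans (≤-reflexive off-0) z≤n))
      -- Out-degree and in-degree together are at most `χ`, so the room in all `q` palettes suffices
      -- for every out-arc.
      (begin-strict
        arrival τ e                 <⟨ arrival-<-out e∈ ⟩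
        length (out-arcs u τ)       ≤⟨ m+n≤o⇒m≤o∸n _ (out+in u) ⟩
        χ ∸ length (in-arcs u τ)    ≤⟨ ∸-monoʳ-≤ χ (below-≤ q) ⟩
        χ ∸ below q                 ≡⟨ cong (_∸ below q) off-q ⟨
        room t u q                  ∎)
      where open ≤-Reasoning

    window : ∀ {e} → e ∈ out-arcs u τ →
      t e < q × off (t e) ≤ arrival τ e + d × arrival τ e < off (suc (t e))
    window {e} e∈ with spec e∈
    ... | t<q , lo , hi = t<q
      , ≤-trans (m∸n≤o⇒m≤o+n′ (off (t e)) lo) (+-monoʳ-≤ (arrival τ e) (≤-trans (below-≤ (t e)) (indeg u)))
      , <-≤-trans hi (m∸n≤m (off (suc (t e))) (below (suc (t e))))
      where
      m∸n≤o⇒m≤o+n′ : ∀ m {n o} → m ∸ n ≤ o → m ≤ o + n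
      m∸n≤o⇒m≤o+n′ m {n} {o} p = ≤-trans (m≤n+m∸n m n) (≤-trans (+-monoʳ-≤ n p) (≤-reflexive (+-comm n o)))

    -- Distinct out-arcs of `u` have distinct arrival numbers, and those placed in palette `s` have
    -- them between two consecutive values of `room`.
    out-bound : ∀ s → length (out-palette t u s) ≤ room t u (suc s) ∸ room t u s
    out-bound s = begin
      length (out-palette t u s)                    ≡⟨ length-map (arrival τ) (out-palette t u s) ⟨
      length (map (arrival τ) (out-palette t u s))  ≤⟨ unique-interval
        (unique-map (arrival τ) inj (Unique.filter⁺ (λ e → s ≟ t e) (Unique.filter⁺ (out? u) uniq)))
        (λ p → let (e , e∈ , eq) = ∈-map⁻ (arrival τ) p in subst (λ k → _ ≤ k × k < _) (sym eq) (bounds e∈)) ⟩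
      room t u (suc s) ∸ room t u s                 ∎
      where
      open ≤-Reasoning
      split : ∀ {e} → e ∈ out-palette t u s → e ∈ out-arcs u τ × s ≡ t e
      split = ∈-filter⁻ (λ e → s ≟ t e) {xs = out-arcs u τ}
      inj : ∀ {e f} → e ∈ out-palette t u s → f ∈ out-palette t u s → arrival τ e ≡ arrival τ f → e ≡ f
      inj e∈ f∈ eq with split e∈ | split f∈
      ... | e∈ , _ | f∈ , _ with proj₂ (∈-filter⁻ (out? u) {xs = τ} e∈) | proj₂ (∈-filter⁻ (out? u) {xs = τ} f∈)
      ... | refl | refl = firstIndex-injective _≟ₑ_ e∈ f∈ eq
      bounds : ∀ {e} → e ∈ out-palette t u s → room t u s ≤ arrival τ e × arrival τ e < room t u (suc s)
      bounds e∈ with split e∈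
      ... | e∈ , refl = proj₂ (spec e∈)

    capacity : ∀ s → length (out-palette t u s) + length (in-palette t u s) + off s ≤ off (suc s)
    capacity s = arith (length (out-palette t u s)) (out-bound s)
      where
      open ≤-Reasoning
      p = length (in-palette t u s)
      arith : ∀ n → n ≤ room t u (suc s) ∸ room t u s → n + p + off s ≤ off (suc s)
      -- Without out-arcs only the at most `d` in-arcs count, and a palette has at least `2d`
      -- colours.
      arith zero _ = begin
        p + off s                    ≤⟨ +-monoˡ-≤ (off s) (unique-⊆-length
          (Unique.filter⁺ (λ e → s ≟ t e) (Unique.filter⁺ (in? u) uniq))
          (λ x∈ → proj₁ (∈-filter⁻ (λ e → s ≟ t e) {xs = in-arcs u τ} x∈))) ⟩
        length (in-arcs u τ) + off s ≤⟨ +-monoˡ-≤ (off s) (≤-trans (indeg u) (m≤m+n d d)) ⟩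
        (d + d) + off s              ≡⟨ +-comm (d + d) (off s) ⟩
        off s + (d + d)              ≤⟨ wide s ⟩
        off (suc s)                  ∎
      -- For positive `n` both truncated differences are genuine, so their subtrahends can be moved
      -- to the other side.
      arith n@(suc _) n≤ = +-cancelˡ-≤ (below s) _ _ (begin
        below s + (n + p + off s)            ≡⟨ shuffle (below s) n p (off s) ⟩
        n + off s + (below s + p)            ≤⟨ +-mono-≤ (+-monoʳ-≤ n (m≤n+m∸n (off s) (below s))) (below-suc s) ⟩
        n + (below s + room t u s) + below (suc s)
                                             ≡⟨ shuffle′ n (below s) (room t u s) (below (suc s)) ⟩
        below s + (n + room t u s + below (suc s))
                                             ≤⟨ +-monoʳ-≤ (below s) (m≤o∸n⇒m+n≤o′ (m≤o∸n⇒m+n≤o′ n≤)) ⟩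
        below s + off (suc s)                ∎)
        where
        open +-*-Solver using (solve; _:+_; _:=_)
        shuffle : ∀ b n p o → b + (n + p + o) ≡ n + o + (b + p)
        shuffle = solve 4 (λ b n p o → b :+ (n :+ p :+ o) := n :+ o :+ (b :+ p)) refl
        shuffle′ : ∀ n b f b′ → n + (b + f) + b′ ≡ b + (n + f + b′)
        shuffle′ = solve 4 (λ n b f b′ → n :+ (b :+ f) :+ b′ := b :+ (n :+ f :+ b′)) refl
        m≤o∸n⇒m+n≤o′ : ∀ {m n o} → suc m ≤ o ∸ n → suc m + n ≤ o
        m≤o∸n⇒m+n≤o′ {m} {n} {o} le = m≤o∸n⇒m+n≤o (suc m)
          (<⇒≤ (m∸n≢0⇒n<m {o} {n} (λ eq → 1+n≰n (≤-trans (s≤s z≤n) (subst (suc m ≤_) eq le))))) le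

    filled : Filled t u
    filled = capacity , window

  palette-stable : ∀ n e → r (tail e) < n → palette (suc n) e ≡ palette n e
  palette-stable n e lt with r (tail e) ≟ n
  ... | yes eq = ⊥-elim (<-irrefl eq lt)
  ... | no _   = refl

  palette-new : ∀ n e → r (tail e) ≡ n →
    palette (suc n) e ≡ locate (room (palette n) (tail e)) (arrival τ e) q
  palette-new n e eq with r (tail e) ≟ n
  ... | yes _ = refl
  ... | no ¬p = ⊥-elim (¬p eq)

  -- Stage `suc n` changes no arc at a vertex of rank below `n`. At a vertex of rank `n` it leaves
  -- the in-arcs alone, so the room computed from the previous stage is still the right one.
  palette-filled : ∀ n u → r u < n → Filled (palette n) u
  palette-filled (suc n) u (s≤s ru≤n) with m≤n⇒m<n∨m≡n ru≤n
  ... | inj₁ ru<n = filled-cong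
    (λ {e} p → let (e∈ , i) = ∈-filter⁻ (inc? u) {xs = τ} p in
       sym (palette-stable n e (≤-<-trans (tail-≤ e∈ i) ru<n)))
    (palette-filled n u ru<n)
    where
    tail-≤ : ∀ {e} → e ∈ τ → Inc u e → r (tail e) ≤ r u
    tail-≤ e∈ (inj₁ refl) = ≤-refl
    tail-≤ e∈ (inj₂ refl) = <⇒≤ (up e∈)
  ... | inj₂ refl = Fill.filled (palette (suc n)) u located
    where
    same-room : ∀ s → room (palette n) u s ≡ room (palette (suc n)) u s
    same-room s = cong (off s ∸_) (≤-antisym (cmp (palette n) (palette (suc n)) id) (cmp (palette (suc n)) (palette n) sym))
      where
      cmp : ∀ (t t′ : Edge → ℕ) → (∀ {e} → palette (suc n) e ≡ palette n e → t′ e ≡ t e) →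
            length (filter (λ e → t e <? s) (in-arcs u τ)) ≤ length (filter (λ e → t′ e <? s) (in-arcs u τ))
      cmp t t′ eq = filter-length-mono (λ e → t e <? s) (λ e → t′ e <? s) (Unique.filter⁺ (in? u) uniq)
        (λ {e} p lt → let (e∈ , i) = ∈-filter⁻ (in? u) {xs = τ} p in
          subst (_< s) (sym (eq (palette-stable n e (subst (r (tail e) <_) (cong r (sym i)) (up e∈))))) lt)
    located : ∀ {e} → e ∈ out-arcs u τ →
      palette (suc n) e ≡ locate (room (palette (suc n)) u) (arrival τ e) q
    located {e} p with ∈-filter⁻ (out? u) {xs = τ} p
    ... | _ , refl = trans (palette-new n e refl) (locate-cong same-room (arrival τ e) q)

  off-mono : ∀ {s s′} → s ≤ s′ → off s ≤ off s′
  off-mono {s} {s′} s≤s′ = subst (λ k → off s ≤ off k) (m+[n∸m]≡n s≤s′) (go (s′ ∸ s))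
    where
    go : ∀ k → off s ≤ off (s + k)
    go zero    = ≤-reflexive (cong off (sym (+-identityʳ s)))
    go (suc k) = ≤-trans (go k) (≤-trans (m≤m+n _ (d + d))
      (≤-trans (wide (s + k)) (≤-reflexive (cong off (sym (+-suc s k))))))

  -- The slack `d` is one-sided: in-arcs take up room and can push an out-arc only towards later
  -- palettes.
  Near : ℕ → ℕ → Set
  Near i k = ∃ λ s → off s ≤ k × k < off (suc s) × off s ≤ i + d × i < off (suc s)

  -- `class-one` colours the arcs of each palette with as many colours as the palette has; shifting
  -- by `off` makes the colour ranges of different palettes disjoint.
  near-arrival-colouring : ∀ N → (∀ u → r u < N) →
    ∃ λ c → Proper τ c × (∀ {e} → e ∈ τ → c e < χ × Near (arrival τ e) (c e))
  near-arrival-colouring N r<N = c , proper , bounds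
    where
    t : Edge → ℕ
    t = palette N
    filled : ∀ u → Filled t u
    filled u = palette-filled N u (r<N u)
    layer : ℕ → List Edge
    layer s = filter (λ e → s ≟ t e) τ
    ∈-layer⁻ : ∀ {s e} → e ∈ layer s → e ∈ τ × s ≡ t e
    ∈-layer⁻ {s} = ∈-filter⁻ (λ e → s ≟ t e) {xs = τ}
    layer-degree : ∀ s v → length (incident v (layer s)) ≤ off (suc s) ∸ off s
    layer-degree s v = begin
      length (incident v (layer s))
        ≤⟨ unique-⊆-length (Unique.filter⁺ (inc? v) (Unique.filter⁺ (λ e → s ≟ t e) uniq)) sub ⟩
      length (out-palette t v s ++ in-palette t v s)
        ≡⟨ length-++ (out-palette t v s) ⟩
      length (out-palette t v s) + length (in-palette t v s)
        ≤⟨ m+n≤o⇒m≤o∸n _ (proj₁ (filled v) s) ⟩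
      off (suc s) ∸ off s ∎
      where
      open ≤-Reasoning
      sub : ∀ {e} → e ∈ incident v (layer s) → e ∈ out-palette t v s ++ in-palette t v s
      sub p with ∈-filter⁻ (inc? v) {xs = layer s} p
      ... | q , i with ∈-layer⁻ q | i
      ... | e∈ , eq | inj₁ o = ∈-++⁺ˡ (∈-filter⁺ (λ e → s ≟ t e) (∈-filter⁺ (out? v) e∈ o) eq)
      ... | e∈ , eq | inj₂ o = ∈-++⁺ʳ (out-palette t v s) (∈-filter⁺ (λ e → s ≟ t e) (∈-filter⁺ (in? v) e∈ o) eq)
    layer-colouring : ∀ s → Colouring (layer s) (off (suc s) ∸ off s)
    layer-colouring s = class-one r d (off (suc s) ∸ off s)
      (m+n≤o⇒m≤o∸n _ (≤-trans (≤-reflexive (+-comm (d + d) (off s))) (wide s)))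
      (layer s) (Unique.filter⁺ (λ e → s ≟ t e) uniq) (up ∘ proj₁ ∘ ∈-layer⁻)
      (λ v → ≤-trans (unique-⊆-length (Unique.filter⁺ (in? v) (Unique.filter⁺ (λ e → s ≟ t e) uniq))
          (λ p → let (q , i) = ∈-filter⁻ (in? v) {xs = layer s} p in ∈-filter⁺ (in? v) (proj₁ (∈-layer⁻ q)) i))
        (indeg v))
      (layer-degree s)
    inner : ℕ → Edge → ℕ
    inner s = proj₁ (layer-colouring s)
    c : Edge → ℕ
    c e = off (t e) + inner (t e) e
    ∈-own : ∀ {e} → e ∈ τ → e ∈ layer (t e)
    ∈-own {e} e∈ = ∈-filter⁺ (λ f → t e ≟ t f) e∈ refl
    c-upper : ∀ {e} → e ∈ τ → c e < off (suc (t e))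
    c-upper {e} e∈ = <-≤-trans
      (+-monoʳ-< (off (t e)) (proj₂ (proj₂ (layer-colouring (t e))) (∈-own e∈)))
      (≤-reflexive (m+[n∸m]≡n (off-mono (n≤1+n (t e)))))
    separated : ∀ {e f} → e ∈ τ → t e < t f → c e ≢ c f
    separated {e} {f} e∈ lt eq = <-irrefl eq
      (<-≤-trans (c-upper e∈) (≤-trans (off-mono lt) (m≤m+n (off (t f)) _)))
    proper : Proper τ c
    proper {v} {e} {f} e∈ f∈ ve vf eq with <-cmp (t e) (t f)
    ... | tri< lt _ _ = ⊥-elim (separated e∈ lt eq)
    ... | tri> _ _ gt = ⊥-elim (separated f∈ gt (sym eq))
    ... | tri≈ _ te≡tf _ = proj₁ (proj₂ (layer-colouring (t e))) (∈-own e∈)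
      (subst (λ s → f ∈ layer s) (sym te≡tf) (∈-own f∈)) ve vf
      (+-cancelˡ-≡ (off (t e)) _ _ (trans eq (cong (λ s → off s + inner s f) (sym te≡tf))))
    bounds : ∀ {e} → e ∈ τ → c e < χ × Near (arrival τ e) (c e)
    bounds {e} e∈ with proj₂ (filled (tail e)) (∈-filter⁺ (out? (tail e)) e∈ refl)
    ... | t<q , lo , hi =
      <-≤-trans (c-upper e∈) (≤-trans (off-mono t<q) (≤-reflexive off-q))
      , t e , m≤m+n _ _ , c-upper e∈ , lo , hi

-- Orienting a degenerate graph

place : Bool → Edge → Edge
place false e       = e
place true  (a , b) = b , a

place-same : ∀ x y {e f} → place x e ≡ place y f → SameEdge e f
place-same false false refl = inj₁ (refl , refl)
place-same false true  refl = inj₂ (refl , refl)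
place-same true  false refl = inj₂ (refl , refl)
place-same true  true  refl = inj₁ (refl , refl)

place-same-self : ∀ x e → SameEdge e (place x e)
place-same-self false e = inj₁ (refl , refl)
place-same-self true  e = inj₂ (refl , refl)

inc-place : ∀ x {v e} → Inc v e → Inc v (place x e)
inc-place false i        = i
inc-place true  (inj₁ p) = inj₂ p
inc-place true  (inj₂ p) = inj₁ p

inc-place⁻ : ∀ x {v e} → Inc v (place x e) → Inc v e
inc-place⁻ false i        = i
inc-place⁻ true  (inj₁ p) = inj₂ p
inc-place⁻ true  (inj₂ p) = inj₁ p

inc⇒adjacent : ∀ {v e f} → Inc v e → Inc v f → Adjacent e f
inc⇒adjacent (inj₁ refl) q = inj₁ q
inc⇒adjacent (inj₂ refl) q = inj₂ q

adjacent⇒inc : ∀ {e f} → Adjacent e f → ∃ λ v → Inc v e × Inc v f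
adjacent⇒inc (inj₁ p) = _ , inj₁ refl , p
adjacent⇒inc (inj₂ p) = _ , inj₂ refl , p

unique-image : ∀ (g : Edge → Edge) → (∀ {e f} → g e ≡ g f → SameEdge e f) →
               ∀ {σ} → SimpleGraph σ → Unique (map g σ)
unique-image g same {[]} _ = []
unique-image g same {e ∷ σ} (_ ∷ loops , distinct) =
  unique-∷ new (unique-image g same (loops , λ i j i≢j → distinct (suc i) (suc j) (i≢j ∘ Fin.suc-injective)))
  where
  new : g e ∉ map g σ
  new p with ∈-map⁻ g p
  ... | f , f∈ , eq = distinct zero (suc (index f∈)) (λ ())
    (subst (SameEdge e) (lookup-index f∈) (same eq))

nth-All : ∀ {P : ℕ → Set} {cs k} → All P cs → k < length cs → P (nth cs k)
nth-All {k = zero}  (p ∷ _)  _       = p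
nth-All {k = suc k} (_ ∷ ps) (s≤s l) = nth-All ps l

nth-map : ∀ (g : Edge → ℕ) σ (i : Fin (length σ)) → nth (map g σ) (toℕ i) ≡ g (lookup σ i)
nth-map g (e ∷ σ) zero    = refl
nth-map g (e ∷ σ) (suc i) = nth-map g σ i

module Orientation (σ : List Edge) (simple : SimpleGraph σ) (flip : Edge → Bool) where

  orient : Edge → Edge
  orient e = place (flip e) e

  τ : List Edge
  τ = map orient σ

  orient-same : ∀ {e f} → orient e ≡ orient f → SameEdge e f
  orient-same {e} {f} = place-same (flip e) (flip f)

  τ-unique : Unique τ
  τ-unique = unique-image orient orient-same simple

  proper-list : ∀ {c} → Proper τ c → ProperColoring σ (map (c ∘ orient) σ)
  proper-list {c} pr = length-map (c ∘ orient) σ , ne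
    where
    ne : ∀ i j → i ≢ j → Adjacent (lookup σ i) (lookup σ j) →
         nth (map (c ∘ orient) σ) (toℕ i) ≢ nth (map (c ∘ orient) σ) (toℕ j)
    ne i j i≢j adj eq with adjacent⇒inc {lookup σ i} {lookup σ j} adj
    ... | v , vi , vj = proj₂ simple i j i≢j (orient-same
      (pr (∈-map⁺ orient (∈-lookup i)) (∈-map⁺ orient (∈-lookup j))
          (inc-place (flip (lookup σ i)) vi) (inc-place (flip (lookup σ j)) vj)
          (trans (sym (nth-map (c ∘ orient) σ i)) (trans eq (nth-map (c ∘ orient) σ j)))))

  -- A colour list is indexed by position, so an arc takes the colour at the position of the edge it
  -- comes from.
  proper-arcs : ∀ {k} → Colorable σ k → Colouring τ k
  proper-arcs {k} (cs , (len , ne) , cs<k) = c , pr , c<k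
    where
    place-of : ∀ e → List Edge → ℕ
    place-of e = firstIndex (λ f → e ≟ₑ orient f)
    c : Edge → ℕ
    c e = nth cs (place-of e σ)
    pos : ∀ {e} → e ∈ τ → ∃ λ (i : Fin (length σ)) → toℕ i ≡ place-of e σ × e ≡ orient (lookup σ i)
    pos {e} e∈ = firstIndex-lookup (λ f → e ≟ₑ orient f) (map⁻ e∈)
    c<k : ∀ {e} → e ∈ τ → c e < k
    c<k e∈ with pos e∈
    ... | i , eq , _ rewrite sym eq = nth-All cs<k (<-≤-trans (toℕ<n i) (≤-reflexive (sym len)))
    pr : Proper τ c
    pr {v} {e} {f} e∈ f∈ ve vf eq with pos e∈ | pos f∈
    ... | i , eqᵢ , refl | j , eqⱼ , refl with i Fin.≟ j
    ... | yes refl = refl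
    ... | no i≢j   = ⊥-elim (ne i j i≢j
      (inc⇒adjacent {e = lookup σ i} {lookup σ j} (inc-place⁻ (flip (lookup σ i)) ve) (inc-place⁻ (flip (lookup σ j)) vf))
      (trans (cong (nth cs) eqᵢ) (trans eq (cong (nth cs) (sym eqⱼ)))))

colouring-degree : ∀ {E k} → Unique E → Colouring E k → ∀ v → length (incident v E) ≤ k
colouring-degree {E} {k} u (c , pr , c<k) v = begin
  length (incident v E)          ≡⟨ length-map c (incident v E) ⟨
  length (map c (incident v E))  ≤⟨ unique-interval {a = 0}
    (unique-map c (λ p q → let (e∈ , ve) = split p ; (f∈ , vf) = split q in pr e∈ f∈ ve vf)
      (Unique.filter⁺ (inc? v) u))
    (λ p → let (e , e∈ , eq) = ∈-map⁻ c p in z≤n , subst (_< k) (sym eq) (c<k (proj₁ (split e∈)))) ⟩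
  k                              ∎
  where
  open ≤-Reasoning
  split : ∀ {e} → e ∈ incident v E → e ∈ E × Inc v e
  split = ∈-filter⁻ (inc? v) {xs = E}

module DegenerateOrientation (σ : List Edge) (simple : SimpleGraph σ)
  (d : ℕ) (ord : List ℕ)
  (covers : All (λ e → proj₁ e ∈ ord × proj₂ e ∈ ord) σ)
  (back : (i : Fin (length ord)) →
    length (filter (hasEdge? σ (lookup ord i)) (take (toℕ i) ord)) ≤ d) where

  rank : ℕ → ℕ
  rank v = firstIndex (v ≟_) ord

  flip : Edge → Bool
  flip (a , b) with rank b <? rank a
  ... | yes _ = true
  ... | no _  = false

  open Orientation σ simple flip public

  rank-≤ : ∀ v → rank v ≤ length ord
  rank-≤ v = firstIndex-≤ (v ≟_) ord

  orient-ends : ∀ {e} → e ∈ σ → tail (orient e) ∈ ord × head (orient e) ∈ ord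
  orient-ends {e} e∈ with flip e | lookupAll covers e∈
  ... | true  | p , q = q , p
  ... | false | p , q = p , q

  orient-up : ∀ {e} → e ∈ σ → rank (tail (orient e)) < rank (head (orient e))
  orient-up {a , b} e∈ with rank b <? rank a
  ... | yes lt = lt
  ... | no ¬lt = ≤∧≢⇒< (≮⇒≥ ¬lt) (λ eq → lookupAll (proj₁ simple) e∈
    (firstIndex-injective _≟_ (proj₁ (lookupAll covers e∈)) (proj₂ (lookupAll covers e∈)) eq))

  up : ∀ {e} → e ∈ τ → rank (tail e) < rank (head e)
  up p with ∈-map⁻ orient p
  ... | e , e∈ , refl = orient-up e∈

  -- The tails of the in-arcs of `v` are distinct neighbours of `v` that precede it in the order.
  indeg : ∀ v → length (in-arcs v τ) ≤ d
  indeg v with v ∈? ord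
  ... | no v∉ = ≤-trans (unique-⊆-length {ys = []} (Unique.filter⁺ (in? v) τ-unique) none) z≤n
    where
    none : ∀ {e} → e ∈ in-arcs v τ → e ∈ []
    none p with ∈-filter⁻ (in? v) {xs = τ} p
    ... | q , refl with ∈-map⁻ orient q
    ... | e , e∈ , refl = ⊥-elim (v∉ (proj₂ (orient-ends e∈)))
  ... | yes v∈ with firstIndex-lookup (v ≟_) v∈
  ... | i , toℕi , v≡ = begin
    length (in-arcs v τ)             ≡⟨ length-map tail (in-arcs v τ) ⟨
    length (map tail (in-arcs v τ))  ≤⟨ unique-⊆-length
      (unique-map tail inj (Unique.filter⁺ (in? v) τ-unique)) sub ⟩
    length (filter (hasEdge? σ (lookup ord i)) (take (toℕ i) ord)) ≤⟨ back i ⟩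
    d                                ∎
    where
    open ≤-Reasoning
    inj : ∀ {e f} → e ∈ in-arcs v τ → f ∈ in-arcs v τ → tail e ≡ tail f → e ≡ f
    inj {e} {f} p q eq = cong₂ _,_ eq
      (trans (sym (proj₂ (∈-filter⁻ (in? v) {xs = τ} p))) (proj₂ (∈-filter⁻ (in? v) {xs = τ} q)))
    sub : ∀ {u} → u ∈ map tail (in-arcs v τ) → u ∈ filter (hasEdge? σ (lookup ord i)) (take (toℕ i) ord)
    sub p with ∈-map⁻ tail p
    ... | a , a∈ , refl with ∈-filter⁻ (in? v) {xs = τ} a∈
    ... | q , v≡head with ∈-map⁻ orient q
    ... | e , e∈ , refl = ∈-filter⁺ (hasEdge? σ (lookup ord i))
      (firstIndex-take (tail (orient e) ≟_) (proj₁ (orient-ends e∈))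
        (<-≤-trans (up q) (≤-reflexive (trans (cong rank (sym v≡head)) (sym toℕi)))))
      (lose e∈ (subst (λ w → SameEdge e (tail (orient e) , w)) (trans (sym v≡head) v≡) (place-same-self (flip e) e)))

-- Colourings close to the arrival numbers

-- The two bounds say that colour plus `bias` minus arrival number lies between 0 and `2 * bias`,
-- the upper end excluded; for `bias = 2 ^ n` this is exactly the range of `n + 1` bits.
record Plan (σ : List Edge) (χ bias : ℕ) : Set where
  field
    simple : SimpleGraph σ
    flip   : Edge → Bool
  open Orientation σ simple flip public
  field
    c      : Edge → ℕ
    proper : Proper τ c
    c<χ    : ∀ {e} → e ∈ τ → c e < χ
    lower  : ∀ {e} → e ∈ τ → arrival τ e ≤ c e + bias
    upper  : ∀ {e} → e ∈ τ → c e < arrival τ e + bias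

-- A palette has at most `2B` colours and the slack is `d ≤ B`; the bias is rounded up to `4B`, a
-- power of two whenever `B` is one.
plan : ∀ {σ χ d B} .{{_ : NonZero B}} → SimpleGraph σ → Colorable σ χ → Degenerate σ d → d + d ≤ B →
       Plan σ χ ((B + B) + (B + B))
plan {σ} {χ} {d} {B} simple colorable (ord , _ , covers , back) 2d≤B with B ≤? χ
... | no B≰χ = record
  { simple = simple ; flip = O.flip ; c = proj₁ c₀ ; proper = proj₁ (proj₂ c₀) ; c<χ = proj₂ (proj₂ c₀)
  ; lower = λ {e} e∈ → ≤-trans (arrival≤χ e∈) (≤-trans χ≤4B (m≤n+m _ (proj₁ c₀ e)))
  ; upper = λ {e} e∈ → <-≤-trans (proj₂ (proj₂ c₀) e∈) (≤-trans χ≤4B (m≤n+m _ (arrival O.τ e))) }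
  where
  module O = DegenerateOrientation σ simple d ord covers back
  c₀ : Colouring O.τ χ
  c₀ = O.proper-arcs colorable
  χ≤4B : χ ≤ (B + B) + (B + B)
  χ≤4B = ≤-trans (<⇒≤ (≰⇒> B≰χ)) (≤-trans (m≤m+n B B) (m≤m+n (B + B) (B + B)))
  arrival≤χ : ∀ {e} → e ∈ O.τ → arrival O.τ e ≤ χ
  arrival≤χ {e} e∈ = ≤-trans (firstIndex-≤ (e ≟ₑ_) (out-arcs (tail e) O.τ))
    (≤-trans (filter-length-mono (out? (tail e)) (inc? (tail e)) O.τ-unique (λ _ → inj₁))
      (colouring-degree O.τ-unique c₀ (tail e)))
... | yes B≤χ = record
  { simple = simple ; flip = O.flip ; c = proj₁ c₁ ; proper = proj₁ (proj₂ c₁)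
  ; c<χ = λ e∈ → proj₁ (proj₂ (proj₂ c₁) e∈)
  ; lower = λ e∈ → near-lower (proj₂ (proj₂ (proj₂ c₁) e∈))
  ; upper = λ e∈ → near-upper (proj₂ (proj₂ (proj₂ c₁) e∈)) }
  where
  open ≤-Reasoning
  module O = DegenerateOrientation σ simple d ord covers back
  q ρ : ℕ
  q = (χ ∸ B) / B
  ρ = (χ ∸ B) % B
  -- Palette 0 absorbs the remainder, so that every palette has between B and 2B colours.
  off : ℕ → ℕ
  off zero    = 0
  off (suc s) = ρ + suc s * B
  off-q : off (suc q) ≡ χ
  off-q = begin-equality
    ρ + (B + q * B)   ≡⟨ +-assoc ρ B (q * B) ⟨
    ρ + B + q * B     ≡⟨ cong (_+ q * B) (+-comm ρ B) ⟩
    B + ρ + q * B     ≡⟨ +-assoc B ρ (q * B) ⟩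
    B + (ρ + q * B)   ≡⟨ cong (B +_) (m≡m%n+[m/n]*n (χ ∸ B) B) ⟨
    B + (χ ∸ B)       ≡⟨ m+[n∸m]≡n B≤χ ⟩
    χ                 ∎
  off-suc : ∀ s → ρ + suc (suc s) * B ≡ ρ + suc s * B + B
  off-suc s = trans (cong (ρ +_) (+-comm B (suc s * B))) (sym (+-assoc ρ (suc s * B) B))
  wide : ∀ s → off s + (d + d) ≤ off (suc s)
  wide zero = ≤-trans 2d≤B (≤-trans (m≤m+n B 0) (m≤n+m (B + 0) ρ))
  wide (suc s) = ≤-trans (+-monoʳ-≤ (ρ + suc s * B) 2d≤B) (≤-reflexive (sym (off-suc s)))
  narrow : ∀ s → off (suc s) ≤ off s + (B + B)
  narrow zero = +-mono-≤ (<⇒≤ (m%n<n (χ ∸ B) B)) (≤-reflexive (+-identityʳ B))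
  narrow (suc s) = ≤-trans (≤-reflexive (off-suc s)) (+-monoʳ-≤ (ρ + suc s * B) (m≤m+n B B))
  module P = Palettes O.τ O.τ-unique O.rank O.up d O.indeg χ
    (colouring-degree O.τ-unique (O.proper-arcs colorable)) off (suc q) refl off-q wide
  c₁ : ∃ λ c → Proper O.τ c × (∀ {e} → e ∈ O.τ → c e < χ × P.Near (arrival O.τ e) (c e))
  -- One more than the length, because a vertex outside `ord` has rank `length ord`.
  c₁ = P.near-arrival-colouring (suc (length ord)) (λ u → s≤s (O.rank-≤ u))
  near-lower : ∀ {i k} → P.Near i k → i ≤ k + ((B + B) + (B + B))
  near-lower {i} {k} (s , s≤k , _ , _ , i<s) = begin
    i                           ≤⟨ <⇒≤ i<s ⟩
    off (suc s)                 ≤⟨ narrow s ⟩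
    off s + (B + B)             ≤⟨ +-mono-≤ s≤k (m≤m+n (B + B) (B + B)) ⟩
    k + ((B + B) + (B + B))     ∎
  near-upper : ∀ {i k} → P.Near i k → k < i + ((B + B) + (B + B))
  near-upper {i} {k} (s , _ , k<s , s≤i , _) = begin-strict
    k                           <⟨ k<s ⟩
    off (suc s)                 ≤⟨ narrow s ⟩
    off s + (B + B)             ≤⟨ +-monoˡ-≤ (B + B) s≤i ⟩
    i + d + (B + B)             ≡⟨ +-assoc i d (B + B) ⟩
    i + (d + (B + B))           ≤⟨ +-monoʳ-≤ i (+-monoˡ-≤ (B + B) (≤-trans (m≤m+n d d) (≤-trans 2d≤B (m≤m+n B B)))) ⟩
    i + ((B + B) + (B + B))     ∎

-- Advice with request

value : ∀ {n} → Vec Bool n → ℕ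
value []                  = 0
value {suc n} (true ∷ w)  = 2 ^ n + value w
value {suc n} (false ∷ w) = value w

value-surjective : ∀ n {k} → k < 2 ^ n → ∃ λ (w : Vec Bool n) → value w ≡ k
value-surjective zero (s≤s z≤n) = [] , refl
value-surjective (suc n) {k} k< with k <? 2 ^ n
... | yes lt = let (w , eq) = value-surjective n lt in false ∷ w , eq
... | no ¬lt = let (w , eq) = value-surjective n (+-cancelˡ-< (2 ^ n) _ _ (begin-strict
                     2 ^ n + (k ∸ 2 ^ n)   ≡⟨ m+[n∸m]≡n (≮⇒≥ ¬lt) ⟩
                     k                     <⟨ k< ⟩
                     2 ^ n + (2 ^ n + 0)   ≡⟨ cong (2 ^ n +_) (+-identityʳ _) ⟩
                     2 ^ n + 2 ^ n         ∎))
               in true ∷ w , trans (cong (2 ^ n +_) eq) (m+[n∸m]≡n (≮⇒≥ ¬lt))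
  where open ≤-Reasoning

-- An advice string is an orientation bit followed by the binary expansion w of
-- colour + 2^n − arrival, where w has n + 1 bits.
oriented : ∀ {b} → Vec Bool b → Edge → Edge
oriented []      e = e
oriented (x ∷ _) e = place x e

colour : ∀ {b} → List Edge → Edge → Vec Bool b → ℕ
colour seen e []                = 0
colour {suc m} seen e (x ∷ w) = length (out-arcs (tail (place x e)) seen) + value w ∸ 2 ^ (m ∸ 1)

-- Each call replays the whole history: `seen` collects the arcs obtained from the orientation bits,
-- and only the last edge is coloured.
play : ∀ {b} → List Edge → List Edge → List (Vec Bool b) → ℕ
play seen []           adv       = 0
play seen (e ∷ es)     []        = 0
play seen (e ∷ [])     (a ∷ _)   = colour seen e a
play seen (e ∷ f ∷ es) (a ∷ adv) = play (seen ++ [ oriented a e ]) (f ∷ es) adv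

algR : AlgR
algR b = play []

run-from : ∀ {b} → List Edge → List Edge → List (Vec Bool b) → List ℕ
run-from seen σ adv = applyUpTo (λ k → play seen (take (suc k) σ) (take (suc k) adv)) (length σ)

run-from-∷ : ∀ {b} seen e σ (a : Vec Bool b) adv →
  run-from seen (e ∷ σ) (a ∷ adv) ≡ colour seen e a ∷ run-from (seen ++ [ oriented a e ]) σ adv
run-from-∷ seen e []      a adv = refl
run-from-∷ seen e (f ∷ σ) a adv = refl

unique-middle : ∀ {A : Set} xs {x : A} {ys} → Unique (xs ++ x ∷ ys) → x ∉ xs
unique-middle (x ∷ xs) u (here refl) = unique-head u (∈-insert xs)
unique-middle (x ∷ xs) u (there x∈)  = unique-middle xs (AllPairs.tail u) x∈

firstIndex-middle : ∀ {e} xs {ys} → e ∉ xs → firstIndex (e ≟ₑ_) (xs ++ e ∷ ys) ≡ length xs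
firstIndex-middle {e} [] e∉ with e ≟ₑ e
... | yes _ = refl
... | no ¬p = ⊥-elim (¬p refl)
firstIndex-middle {e} (x ∷ xs) e∉ with e ≟ₑ x
... | yes p = ⊥-elim (e∉ (here p))
... | no _  = cong suc (firstIndex-middle xs (e∉ ∘ there))

-- As arcs are distinct, the arrival number in the complete sequence is already determined by the
-- past; here the oracle's view meets the algorithm's.
arrival-middle : ∀ seen e {rest} → Unique (seen ++ e ∷ rest) →
  arrival (seen ++ e ∷ rest) e ≡ length (out-arcs (tail e) seen)
arrival-middle seen e {rest} u = trans
  (cong (firstIndex (e ≟ₑ_)) (trans (filter-++ (out? (tail e)) seen (e ∷ rest))
    (cong (out-arcs (tail e) seen ++_) (filter-accept (out? (tail e)) {xs = rest} refl))))
  (firstIndex-middle (out-arcs (tail e) seen)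
    (unique-middle seen u ∘ proj₁ ∘ ∈-filter⁻ (out? (tail e)) {xs = seen}))

module _ {σ : List Edge} {χ n : ℕ} (p : Plan σ χ (2 ^ n)) where
  open Plan p

  -- By `lower` the truncated difference to be encoded is genuine, so `colour` can undo it; by
  -- `upper` it is below `2 ^ suc n` and fits into the bits after the orientation bit.
  advise-edge : ∀ e seen → orient e ∈ τ → arrival τ (orient e) ≡ length (out-arcs (tail (orient e)) seen) →
    ∃ λ (a : Vec Bool (2 + n)) → oriented a e ≡ orient e × colour seen e a ≡ c (orient e)
  advise-edge e seen o∈ arr with value-surjective (suc n) {c (orient e) + 2 ^ n ∸ arrival τ (orient e)} small
    where
    open ≤-Reasoning
    small : c (orient e) + 2 ^ n ∸ arrival τ (orient e) < 2 ^ suc n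
    small = +-cancelˡ-< (arrival τ (orient e)) _ _ (begin-strict
      arrival τ (orient e) + (c (orient e) + 2 ^ n ∸ arrival τ (orient e)) ≡⟨ m+[n∸m]≡n (lower o∈) ⟩
      c (orient e) + 2 ^ n                              <⟨ +-monoˡ-< (2 ^ n) (upper o∈) ⟩
      arrival τ (orient e) + 2 ^ n + 2 ^ n              ≡⟨ +-assoc (arrival τ (orient e)) (2 ^ n) (2 ^ n) ⟩
      arrival τ (orient e) + (2 ^ n + 2 ^ n)            ≡⟨ cong (λ k → arrival τ (orient e) + (2 ^ n + k)) (+-identityʳ _) ⟨
      arrival τ (orient e) + 2 ^ suc n                  ∎)
  ... | w , eq = flip e ∷ w , refl , (begin
    length (out-arcs (tail (orient e)) seen) + value w ∸ 2 ^ n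
      ≡⟨ cong₂ (λ i k → i + k ∸ 2 ^ n) (sym arr) eq ⟩
    arrival τ (orient e) + (c (orient e) + 2 ^ n ∸ arrival τ (orient e)) ∸ 2 ^ n
      ≡⟨ cong (_∸ 2 ^ n) (m+[n∸m]≡n (lower o∈)) ⟩
    c (orient e) + 2 ^ n ∸ 2 ^ n
      ≡⟨ m+n∸n≡m (c (orient e)) (2 ^ n) ⟩
    c (orient e) ∎)
    where open ≡-Reasoning

  -- Induction along the input, with the invariant that the arcs decoded so far form a prefix of
  -- `τ`.
  advise : ∀ seen rest → seen ++ map orient rest ≡ τ →
    ∃ λ (adv : List (Vec Bool (2 + n))) → length adv ≡ length rest ×
      run-from seen rest adv ≡ map (c ∘ orient) rest
  advise seen [] eq = [] , refl , refl
  advise seen (e ∷ rest) eq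
    with advise-edge e seen (subst (orient e ∈_) eq (∈-insert seen))
           (trans (cong (λ t → arrival t (orient e)) (sym eq))
                  (arrival-middle seen (orient e) (subst Unique (sym eq) τ-unique)))
  ... | a , or , col with advise (seen ++ [ orient e ]) rest (trans (++-assoc seen [ orient e ] _) eq)
  ... | adv , len , run = a ∷ adv , cong suc len , trans (run-from-∷ seen e rest a adv)
    (cong₂ _∷_ col (trans (cong (λ o → run-from (seen ++ [ o ]) rest adv) or) run))

record GoodAdvice (σ : List Edge) (χ b : ℕ) (adv : List (Vec Bool b)) : Set where
  constructor good
  field
    proper : ProperColoring σ (runR algR b σ adv)
    small  : All (_< χ) (runR algR b σ adv)

Advisable : List Edge → ℕ → ℕ → Set
Advisable σ χ b = ∃ λ (adv : List (Vec Bool b)) → length adv ≡ length σ × GoodAdvice σ χ b adv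

plan-advisable : ∀ {σ χ n} → Plan σ χ (2 ^ n) → Advisable σ χ (2 + n)
plan-advisable {σ} {χ} {n} p with advise p [] σ refl
... | adv , len , run = adv , len , good
  (subst (ProperColoring σ) (sym run) (proper-list proper))
  (subst (All (_< χ)) (sym run) (tabulateAll (λ q → let (e , e∈ , eq) = ∈-map⁻ (c ∘ orient) q in
    subst (_< χ) (sym eq) (c<χ (∈-map⁺ orient e∈)))))
  where open Plan p

-- Finite search for colourings and advice

adjacent? : ∀ e f → Dec (Adjacent e f)
adjacent? (a , b) (c , d) = ((a ≟ c) ⊎-dec (a ≟ d)) ⊎-dec ((b ≟ c) ⊎-dec (b ≟ d))

proper? : ∀ σ cs → Dec (ProperColoring σ cs)
proper? σ cs = (length cs ≟ length σ) ×-dec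
  Fin.all? (λ i → Fin.all? (λ j → ¬? (i Fin.≟ j) →-dec
    (adjacent? (lookup σ i) (lookup σ j) →-dec ¬? (nth cs (toℕ i) ≟ nth cs (toℕ j)))))

∃-list? : ∀ {A : Set} (enum : List A) → (∀ a → a ∈ enum) → ∀ n {P : List A → Set} →
  (∀ xs → Dec (P xs)) → Dec (∃ λ xs → length xs ≡ n × P xs)
∃-list? enum complete zero P? = map′ (λ p → [] , refl , p) (λ { ([] , _ , p) → p }) (P? [])
∃-list? enum complete (suc n) {P} P? = map′ cons uncons
  (any? (λ a → ∃-list? enum complete n (λ xs → P? (a ∷ xs))) enum)
  where
  Rest : _ → Set
  Rest a = ∃ λ xs → length xs ≡ n × P (a ∷ xs)
  cons : Any Rest enum → ∃ λ xs → length xs ≡ suc n × P xs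
  cons p = let (a , xs , len , q) = satisfied p in a ∷ xs , cong suc len , q
  uncons : (∃ λ xs → length xs ≡ suc n × P xs) → Any Rest enum
  uncons (a ∷ xs , len , q) = lose (complete a) (xs , suc-injective len , q)

bit-vectors : ∀ b → List (Vec Bool b)
bit-vectors zero    = [ [] ]
bit-vectors (suc b) = map (true ∷_) (bit-vectors b) ++ map (false ∷_) (bit-vectors b)

∈-bit-vectors : ∀ {b} (w : Vec Bool b) → w ∈ bit-vectors b
∈-bit-vectors []          = here refl
∈-bit-vectors (true ∷ w)  = ∈-++⁺ˡ (∈-map⁺ (true ∷_) (∈-bit-vectors w))
∈-bit-vectors (false ∷ w) = ∈-++⁺ʳ _ (∈-map⁺ (false ∷_) (∈-bit-vectors w))

advisable? : ∀ σ χ b → Dec (Advisable σ χ b)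
advisable? σ χ b = ∃-list? (bit-vectors b) ∈-bit-vectors (length σ)
  (λ adv → map′ (λ (p , s) → good p s) (λ (good p s) → p , s)
    (proper? σ (runR algR b σ adv) ×-dec all? (_<? χ) (runR algR b σ adv)))

-- Lists over `Fin k` make the search space for `k`-colourings finite.
fins : ∀ {k cs} → All (_< k) cs → ∃ λ (xs : List (Fin k)) → map toℕ xs ≡ cs
fins []         = [] , refl
fins (c<k ∷ ps) = let (xs , eq) = fins ps in fromℕ< c<k ∷ xs , cong₂ _∷_ (toℕ-fromℕ< c<k) eq

colorable? : ∀ σ k → Dec (Colorable σ k)
colorable? σ k = map′
  (λ (xs , _ , pr) → map toℕ xs , pr ,
     tabulateAll (λ p → let (i , _ , eq) = ∈-map⁻ toℕ p in subst (_< k) (sym eq) (toℕ<n i)))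
  (λ (cs , pr , small) → let (xs , eq) = fins small in
     xs , trans (sym (length-map toℕ xs)) (trans (cong length eq) (proj₁ pr)) , subst (ProperColoring σ) (sym eq) pr)
  (∃-list? (allFin k) ∈-allFin (length σ) (λ xs → proper? σ (map toℕ xs)))

least : ∀ {P : ℕ → Set} → (∀ n → Dec (P n)) → ∀ n → P n → ∃ λ m → P m × (∀ k → P k → m ≤ k)
least P? n p with P? 0
least P? n p | yes p₀ = 0 , p₀ , λ _ _ → z≤n
least P? zero p | no ¬p₀ = ⊥-elim (¬p₀ p)
least P? (suc n) p | no ¬p₀ = let (m , pm , min) = least (P? ∘ suc) n p in
  suc m , pm , λ { zero pk → ⊥-elim (¬p₀ pk) ; (suc k) pk → s≤s (min k pk) }

nth-applyUpTo : ∀ f n {k} → k < n → nth (applyUpTo f n) k ≡ f k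
nth-applyUpTo f (suc n) {zero}  _         = refl
nth-applyUpTo f (suc n) {suc k} (s≤s k<n) = nth-applyUpTo (f ∘ suc) n k<n

-- Giving every edge its own colour provides the bound from which the search for the chromatic index
-- starts.
rainbow : ∀ σ → Colorable σ (length σ)
rainbow σ = upTo (length σ) , (length-upTo (length σ) , λ i j i≢j _ eq → i≢j (toℕ-injective
    (trans (sym (nth-applyUpTo id (length σ) (toℕ<n i))) (trans eq (nth-applyUpTo id (length σ) (toℕ<n j))))))
  , tabulateAll ∈-upTo⁻

chromatic-index : ∀ σ → ∃ (IsChromaticIndex σ)
chromatic-index σ = least (colorable? σ) (length σ) (rainbow σ)

-- The length of the shortest advice

<2^suc-log : ∀ d → d < 2 ^ suc ⌊log₂ d ⌋
<2^suc-log d = ≰⇒> (λ le → 1+n≰n (≤-trans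
  (≤-reflexive (sym (⌊log₂[2^n]⌋≡n (suc ⌊log₂ d ⌋)))) (⌊log₂⌋-mono-≤ le)))

-- With `l = ⌊log₂ d ⌋` one has `d ≤ 2 ^ (1 + l)`, so `B = 2 ^ (2 + l)` is at least `2d`. The bias
-- `4B` is `2 ^ (4 + l)`, which costs `5 + l` bits and the orientation bit.
advisable-degenerate : ∀ {σ χ d} → SimpleGraph σ → Colorable σ χ → Degenerate σ d →
  Advisable σ χ (6 + ⌊log₂ d ⌋)
advisable-degenerate {σ} {χ} {d} simple col deg = plan-advisable
  (subst (Plan σ χ) (four (2 ^ (2 + ⌊log₂ d ⌋)))
    (plan {B = 2 ^ (2 + ⌊log₂ d ⌋)} {{m^n≢0 2 (2 + ⌊log₂ d ⌋)}} simple col deg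
      (≤-trans (+-mono-≤ d≤ d≤) (≤-reflexive (cong (2 ^ suc ⌊log₂ d ⌋ +_) (sym (+-identityʳ _)))))))
  where
  open +-*-Solver
  d≤ : d ≤ 2 ^ suc ⌊log₂ d ⌋
  d≤ = <⇒≤ (<2^suc-log d)
  four : ∀ B → (B + B) + (B + B) ≡ 2 * (2 * B)
  four = solve 1 (λ B → (B :+ B) :+ (B :+ B) := con 2 :* (con 2 :* B)) refl

-- Any enumeration of the vertices serves, with their number as `d`; this gives the search for the
-- shortest advice a place to start.
some-degeneracy : ∀ σ → ∃ (Degenerate σ)
some-degeneracy σ = length ord , ord , deduplicate-! ends
  , tabulateAll (λ e∈ → ∈-deduplicate⁺ _≟_ (∈-++⁺ˡ (∈-map⁺ tail e∈))
                      , ∈-deduplicate⁺ _≟_ (∈-++⁺ʳ (map tail σ) (∈-map⁺ head e∈)))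
  , λ i → ≤-trans (length-filter (hasEdge? σ (lookup ord i)) (take (toℕ i) ord))
            (≤-trans (≤-reflexive (length-take (toℕ i) ord)) (m⊓n≤n (toℕ i) (length ord)))
  where
  ends ord : List ℕ
  ends = map tail σ ++ map head σ
  ord = deduplicate _≟_ ends

-- Since `b` is chosen minimal, without reference to any `d`, a single piece of advice satisfies
-- `short` for all `d` at once.
record Advice (σ : List Edge) : Set where
  field
    b       : ℕ
    adv     : List (Vec Bool b)
    len     : length adv ≡ length σ
    optimal : OptimalColoring σ (runR algR b σ adv)
    short   : ∀ {d} → Degenerate σ d → b ≤ 6 + ⌊log₂ d ⌋

advice : ∀ σ → SimpleGraph σ → Advice σ
advice σ simple = record
  { b = b ; adv = adv ; len = len
  ; optimal = GoodAdvice.proper best , λ k (col′ , _) → upTo χ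
      , ≤-trans (≤-reflexive (length-upTo χ)) (minimal k col′) , All.map ∈-upTo⁺ (GoodAdvice.small best)
  ; short = λ deg → shortest _ (advisable-degenerate simple col deg) }
  where
  χ = proj₁ (chromatic-index σ)
  col : Colorable σ χ
  col = proj₁ (proj₂ (chromatic-index σ))
  minimal : ∀ k → Colorable σ k → χ ≤ k
  minimal = proj₂ (proj₂ (chromatic-index σ))
  shortest-advice : ∃ λ b → Advisable σ χ b × (∀ k → Advisable σ χ k → b ≤ k)
  shortest-advice = least (advisable? σ χ) _
    (advisable-degenerate simple col (proj₂ (some-degeneracy σ)))
  b = proj₁ shortest-advice
  adv : List (Vec Bool b)
  adv = proj₁ (proj₁ (proj₂ shortest-advice))
  len : length adv ≡ length σ
  len = proj₁ (proj₂ (proj₁ (proj₂ shortest-advice)))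
  best : GoodAdvice σ χ b adv
  best = proj₂ (proj₂ (proj₁ (proj₂ shortest-advice)))
  shortest : ∀ k → Advisable σ χ k → b ≤ k
  shortest = proj₂ (proj₂ shortest-advice)

advice-with-request : AdviceWithRequestClaim
advice-with-request = algR , 6 , λ σ simple → let open Advice (advice σ simple) in
  b , adv , len , optimal , λ d (deg , _) → begin
    b * length σ                          ≤⟨ *-monoˡ-≤ (length σ) (short deg) ⟩
    (6 + ⌊log₂ d ⌋) * length σ            ≤⟨ *-monoˡ-≤ (length σ) (+-monoʳ-≤ 6 (m≤m+n ⌊log₂ d ⌋ (5 * ⌊log₂ d ⌋))) ⟩
    (6 + 6 * ⌊log₂ d ⌋) * length σ        ≡⟨ rearrange ⌊log₂ d ⌋ (length σ) ⟩
    6 * length σ * (1 + ⌊log₂ d ⌋)        ∎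
  where
  open ≤-Reasoning
  open +-*-Solver
  rearrange : ∀ l m → (6 + 6 * l) * m ≡ 6 * m * (1 + l)
  rearrange = solve 2 (λ l m → (con 6 :+ con 6 :* l) :* m := con 6 :* m :* (con 1 :+ l)) refl

-- Advice on tape

-- Short input is padded with `false` for totality; `serve-with` decodes once all `b * length es`
-- bits have been read.
chunk : ∀ b → List Bool → Vec Bool b
chunk zero    _        = []
chunk (suc b) []       = false ∷ chunk b []
chunk (suc b) (x ∷ xs) = x ∷ chunk b xs

chunks : ∀ b → ℕ → List Bool → List (Vec Bool b)
chunks b zero    xs = []
chunks b (suc n) xs = chunk b xs ∷ chunks b n (drop b xs)

flatten : ∀ {b} → List (Vec Bool b) → List Bool
flatten = concatMap toList

length-flatten : ∀ {b} (adv : List (Vec Bool b)) → length (flatten adv) ≡ b * length adv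
length-flatten {b} [] = sym (*-zeroʳ b)
length-flatten {b} (a ∷ adv) = trans (length-++ (toList a)) (trans
  (cong₂ _+_ (length-toList a) (length-flatten adv)) (sym (*-suc b (length adv))))

chunk-take : ∀ {b} (a : Vec Bool b) k ys → chunk b (take (b + k) (toList a ++ ys)) ≡ a
chunk-take []      k ys = refl
chunk-take (x ∷ a) k ys = cong (x ∷_) (chunk-take a k ys)

drop-take : ∀ {b} (a : Vec Bool b) k ys → drop b (take (b + k) (toList a ++ ys)) ≡ take k ys
drop-take []      k ys = refl
drop-take (x ∷ a) k ys = drop-take a k ys

chunks-take : ∀ {b} (adv : List (Vec Bool b)) n → n ≤ length adv →
  chunks b n (take (b * n) (flatten adv)) ≡ take n adv
chunks-take adv zero _ = refl
chunks-take {b} (a ∷ adv) (suc n) (s≤s n≤) rewrite *-suc b n = cong₂ _∷_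
  (chunk-take a (b * n) (flatten adv))
  (trans (cong (chunks b n) (drop-take a (b * n) (flatten adv))) (chunks-take adv n n≤))

-- The tape holds 1^b 0 followed by the b-bit advice strings.
serve-with : ℕ → List Edge → List Bool → Maybe ℕ
serve-with b es xs with length xs <? b * length es
... | yes _ = nothing
... | no _  = just (algR b es (chunks b (length es) xs))

-- The number counts the ones of the header seen so far. The header is parsed anew in every call, as
-- the algorithm is given all bits read so far.
parse : ℕ → List Edge → List Bool → Maybe ℕ
parse b es []           = nothing
parse b es (true ∷ xs)  = parse (suc b) es xs
parse b es (false ∷ xs) = serve-with b es xs

algT : AlgT
algT = parse 0

encoding : ℕ → List Bool → List Bool
encoding b F = replicate b true ++ false ∷ F

parse-header : ∀ b b₀ {es F r} → r ≤ b → parse b₀ es (take r (encoding b F)) ≡ nothing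
parse-header b       b₀ z≤n     = refl
parse-header (suc b) b₀ (s≤s p) = parse-header b (suc b₀) p

parse-body : ∀ b b₀ {es F} j →
  parse b₀ es (take (b + suc j) (encoding b F)) ≡ serve-with (b + b₀) es (take j F)
parse-body zero    b₀ j = refl
parse-body (suc b) b₀ {es} {F} j =
  trans (parse-body b (suc b₀) j) (cong (λ k → serve-with k es (take j F)) (+-suc b b₀))

serve-short : ∀ {b es xs} → length xs < b * length es → serve-with b es xs ≡ nothing
serve-short {b} {es} {xs} lt with length xs <? b * length es
... | yes _  = refl
... | no ¬lt = ⊥-elim (¬lt lt)

serve-long : ∀ {b es xs} → b * length es ≤ length xs →
  serve-with b es xs ≡ just (algR b es (chunks b (length es) xs))
serve-long {b} {es} {xs} le with length xs <? b * length es
... | yes lt = ⊥-elim (<-irrefl refl (<-≤-trans lt le))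
... | no _   = refl

bit-at : List Bool → ℕ → Bool
bit-at []       _       = false
bit-at (x ∷ xs) zero    = x
bit-at (x ∷ xs) (suc i) = bit-at xs i

prefix-bit-at : ∀ xs r → r ≤ length xs → prefix (bit-at xs) r ≡ take r xs
prefix-bit-at xs       zero    _       = refl
prefix-bit-at (x ∷ xs) (suc r) (s≤s p) = cong (x ∷_) (prefix-bit-at xs r p)

serve : ∀ {alg tape es c} k {r r′} → r + k ≡ r′ →
  (∀ s → r ≤ s → s < r′ → alg es (prefix tape s) ≡ nothing) →
  alg es (prefix tape r′) ≡ just c → Serve alg tape es r r′ c
serve zero {r} eq wait out with trans (sym (+-identityʳ r)) eq
... | refl = output out
serve (suc k) {r} eq wait out = read
  (wait r ≤-refl (≤-trans (m<m+n r (s≤s z≤n)) (≤-reflexive eq)))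
  (serve k (trans (sym (+-suc r k)) eq) (λ s r<s → wait s (<⇒≤ r<s)) out)

take-snoc : ∀ {A : Set} (xs : List A) k → k < length xs → ∃ λ x → take (suc k) xs ≡ take k xs ++ [ x ]
take-snoc xs k k< = lookup xs i , subst (λ n → take (suc n) xs ≡ take n xs ++ [ lookup xs i ])
  (toℕ-fromℕ< k<) (take-suc xs i)
  where i = fromℕ< k<

module Tape (σ : List Edge) {b : ℕ} (adv : List (Vec Bool b)) (len : length adv ≡ length σ) where

  F T : List Bool
  F = flatten adv
  T = encoding b F

  length-T : length T ≡ b + suc (b * length σ)
  length-T = trans (length-++ (replicate b true)) (cong₂ (λ x y → x + suc y) (length-replicate b)
    (trans (length-flatten adv) (cong (b *_) len)))

  -- The header of `b + 1` bits is read with the first edge, so an empty input reads nothing.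
  bits-read : ℕ → ℕ
  bits-read zero    = 0
  bits-read (suc k) = b + suc (b * suc k)

  bits-read-mono : ∀ k → bits-read k ≤ bits-read (suc k)
  bits-read-mono zero    = z≤n
  bits-read-mono (suc k) = +-monoʳ-≤ b (s≤s (*-monoʳ-≤ b (n≤1+n (suc k))))

  output-at : ℕ → ℕ
  output-at k = algR b (take (suc k) σ) (take (suc k) adv)

  serve-edge : ∀ k → k < length σ →
    Serve algT (bit-at T) (take (suc k) σ) (bits-read k) (bits-read (suc k)) (output-at k)
  serve-edge k k<m = serve (bits-read (suc k) ∸ bits-read k) (m+[n∸m]≡n (bits-read-mono k))
    (λ s _ s< → trans (cong (algT es) (prefix-bit-at T s (≤-trans (<⇒≤ s<) fits))) (wait s s<)) out
    where
    es : List Edge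
    es = take (suc k) σ
    length-es : length es ≡ suc k
    length-es = trans (length-take (suc k) σ) (m≤n⇒m⊓n≡m k<m)
    fits : bits-read (suc k) ≤ length T
    fits = ≤-trans (+-monoʳ-≤ b (s≤s (*-monoʳ-≤ b k<m))) (≤-reflexive (sym length-T))
    body : ∀ j → algT es (take (b + suc j) T) ≡ serve-with b es (take j F)
    body j = trans (parse-body b 0 j) (cong (λ n → serve-with n es (take j F)) (+-identityʳ b))
    length-F : ∀ j → j ≤ b * suc k → length (take j F) ≡ j
    length-F j j≤ = trans (length-take j F) (m≤n⇒m⊓n≡m (≤-trans j≤ (≤-trans (*-monoʳ-≤ b k<m)
      (≤-reflexive (sym (trans (length-flatten adv) (cong (b *_) len)))))))
    wait : ∀ s → s < bits-read (suc k) → algT es (take s T) ≡ nothing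
    wait s s< with s ≤? b
    ... | yes s≤b = parse-header b 0 s≤b
    ... | no s≰b = subst (λ n → algT es (take n T) ≡ nothing) s≡ (trans (body j)
        (serve-short {b} {es} (≤-<-trans (≤-reflexive (length-F j (<⇒≤ j<)))
          (<-≤-trans j< (≤-reflexive (cong (b *_) (sym length-es)))))))
      where
      j : ℕ
      -- The number of advice bits read beyond the header.
      j = s ∸ suc b
      s≡ : b + suc j ≡ s
      s≡ = trans (+-suc b j) (m+[n∸m]≡n (≰⇒> s≰b))
      j< : j < b * suc k
      j< = ≤-pred (+-cancelˡ-< b _ _ (≤-trans (≤-reflexive (cong suc s≡)) s<))
    out : algT es (prefix (bit-at T) (bits-read (suc k))) ≡ just (output-at k)
    out = begin
      algT es (prefix (bit-at T) (bits-read (suc k)))  ≡⟨ cong (algT es) (prefix-bit-at T (bits-read (suc k)) fits) ⟩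
      algT es (take (b + suc (b * suc k)) T)           ≡⟨ body (b * suc k) ⟩
      serve-with b es G                                ≡⟨ serve-long {b} {es} (≤-reflexive
        (trans (cong (b *_) length-es) (sym (length-F (b * suc k) ≤-refl)))) ⟩
      just (algR b es (chunks b (length es) G))        ≡⟨ cong (λ n → just (algR b es (chunks b n G))) length-es ⟩
      just (algR b es (chunks b (suc k) G))            ≡⟨ cong (just ∘ algR b es)
        (chunks-take adv (suc k) (≤-trans k<m (≤-reflexive (sym len)))) ⟩
      just (output-at k)                               ∎
      where
      open ≡-Reasoning
      G : List Bool
      G = take (b * suc k) F

  run-prefix : ∀ k → k ≤ length σ → RunT algT (bit-at T) (take k σ) (applyUpTo output-at k) (bits-read k)
  run-prefix zero _ = start
  run-prefix (suc k) k<m with take-snoc σ k k<m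
  ... | e , eq = subst₂ (λ es cs → RunT algT (bit-at T) es cs (bits-read (suc k)))
    (sym eq) (applyUpTo-∷ʳ output-at k)
    (step (run-prefix k (<⇒≤ k<m))
      (subst (λ es → Serve algT (bit-at T) es (bits-read k) (bits-read (suc k)) (output-at k)) eq (serve-edge k k<m)))

  run : RunT algT (bit-at T) σ (runR algR b σ adv) (bits-read (length σ))
  run = subst (λ es → RunT algT (bit-at T) es (runR algR b σ adv) (bits-read (length σ)))
    (take-all (length σ) σ ≤-refl) (run-prefix (length σ) ≤-refl)

  -- As soon as there is an edge, the header can be charged at `1 + b` bits per edge.
  bits-read-≤ : ∀ k → bits-read k ≤ (1 + b + b) * k
  bits-read-≤ zero    = z≤n
  bits-read-≤ (suc k) = begin
    b + suc (b * suc k)            ≡⟨ +-suc b (b * suc k) ⟩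
    1 + b + b * suc k              ≤⟨ +-monoˡ-≤ (b * suc k) (m≤m*n (1 + b) (suc k)) ⟩
    (1 + b) * suc k + b * suc k    ≡⟨ *-distribʳ-+ (suc k) (1 + b) b ⟨
    (1 + b + b) * suc k            ∎
    where open ≤-Reasoning

advice-on-tape : AdviceOnTapeClaim
advice-on-tape = algT , 13 , λ σ simple →
  let open Advice (advice σ simple)
      open Tape σ adv len
  in bit-at T , runR algR b σ adv , bits-read (length σ) , run , optimal , λ d (deg , _) → begin
    bits-read (length σ)                     ≤⟨ bits-read-≤ (length σ) ⟩
    -- With `b ≤ 6 + l` the factor is at most `13 + 2 * l`, which `11 * l` completes to
    -- `13 * (1 + l)`.
    (1 + b + b) * length σ                   ≤⟨ *-monoˡ-≤ (length σ) (+-mono-≤ (s≤s (short deg)) (short deg)) ⟩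
    (1 + (6 + ⌊log₂ d ⌋) + (6 + ⌊log₂ d ⌋)) * length σ
                                             ≤⟨ *-monoˡ-≤ (length σ) (m≤m+n (1 + (6 + ⌊log₂ d ⌋) + (6 + ⌊log₂ d ⌋)) (11 * ⌊log₂ d ⌋)) ⟩
    (1 + (6 + ⌊log₂ d ⌋) + (6 + ⌊log₂ d ⌋) + 11 * ⌊log₂ d ⌋) * length σ
                                             ≡⟨ rearrange ⌊log₂ d ⌋ (length σ) ⟩
    13 * length σ * (1 + ⌊log₂ d ⌋)          ∎
  where
  open ≤-Reasoning
  open +-*-Solver
  rearrange : ∀ l m → (1 + (6 + l) + (6 + l) + 11 * l) * m ≡ 13 * m * (1 + l)
  rearrange = solve 2 (λ l m → (con 1 :+ (con 6 :+ l) :+ (con 6 :+ l) :+ con 11 :* l) :* m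
                               := con 13 :* m :* (con 1 :+ l)) refl

theorem3 : AdviceWithRequestClaim × AdviceOnTapeClaim
theorem3 = advice-with-request , advice-on-tape
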